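{- Let $G$ be an embedded graph, let $k\in\mathbb{N}$, and let $b\in\mathbb{C}\setminus\{0\}$. Then $$k^{c(G)}R(G;k+1,k,1/k)=\sum_{\phi\in\mathcal{R}(G_m,k)}2^{\mathrm{tot}(\phi)};$$ $$P(G;k)=\sum_{\phi\in\mathcal{A}(G_m,k)}(-1)^{\mathrm{cr}(\phi)};$$ $$k^{c(G)}b^{r(G)}R\Big(G;\frac{k+b}{b},bk,\frac1k\Big)=\sum_{\phi\in\mathcal{R}(G_m,k)}(b+1)^{\mathrm{tot}(\phi)}b^{\mathrm{wh}(\phi)};$$ and, when $G$ is plane, $$k^{c(G)}b^{r(G)}\,T\Big(G;\frac{k}{b}+1,kb+1\Big)=\sum_{\phi\in\mathcal{R}(G_m,k)}(b+1)^{\mathrm{tot}(\phi)}b^{\mathrm{wh}(\phi)}.$$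
   Context: An embedded graph is a graph (loops and multiple edges allowed, not necessarily connected) cellularly embedded in a closed, possibly non-orientable, surface, i.e. each component of the complement (each face) is an open disc. Equivalently, it is a ribbon graph: a surface with boundary written as a union of vertex discs and edge discs (ribbons), each edge disc meeting the vertex discs in exactly two disjoint arcs. $c(G)$ is the number of connected components, $r(G)=|V(G)|-c(G)$, $n(G)=|E(G)|-r(G)$, and $f(G)$ is the number of boundary components of the ribbon graph (number of faces). For $A\subseteq E(G)$, $c(A),r(A),n(A),f(A)$ refer to the spanning ribbon subgraph $(V(G),A)$. $G$ is plane if it is connected and has Euler genus $0$ (i.e. $|V(G)|-|E(G)|+f(G)=2$). Ribbon graph (Bollobás–Riordan) polynomial: $R(G;x,y,z)=\sum_{A\subseteq E(G)}(x-1)^{r(G)-r(A)}y^{n(A)}z^{c(A)-f(A)+n(A)}$. Tutte polynomial: $T(G;x,y)=\sum_{A\subseteq E(G)}(x-1)^{r(G)-r(A)}(y-1)^{n(A)}$. Penrose polynomial: $P(G;\lambda)=\sum_{A\subseteq E(G)}(-1)^{|A|}\lambda^{f(G^{\tau(A)})}$, where the partial Petrial $G^{\tau(A)}$ is the ribbon graph obtained from $G$ by adding a half-twist to each edge in $A$. Medial graph: $G_m$ is the 4-regular graph embedded in the same surface obtained by placing a vertex $v_e$ on each edge $e$ of $G$ and drawing the edges of $G_m$ by following the face boundaries of $G$. An isolated vertex of $G$ contributes a free loop (a circular edge with no vertex), which counts as an edge of $G_m$. The canonical checkerboard colouring of $G_m$ colours black the faces of $G_m$ containing a vertex of $G$ and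 colours white the remaining faces (which correspond to the faces of $G$). $k$-valuations: a $k$-valuation of $G_m$ is a map $\phi:E(G_m)\to\{1,\dots,k\}$ (free loops are coloured too) such that for every colour $i$ and every vertex $v$ the number of $i$-coloured half-edges at $v$ is even. At a vertex $v$ let $h_1,h_2,h_3,h_4$ be the incident half-edges in cyclic order, labelled so that the corners between $h_1,h_2$ and between $h_3,h_4$ are white and those between $h_2,h_3$ and between $h_4,h_1$ are black. The type of $\phi$ at $v$ is total if all four half-edges have the same colour; otherwise two distinct colours occur, each twice, and the type is white if $h_1,h_2$ agree and $h_3,h_4$ agree; black if $h_2,h_3$ agree and $h_4,h_1$ agree; crossing if $h_1,h_3$ agree and $h_2,h_4$ agree. $\mathrm{tot}(\phi),\mathrm{wh}(\phi),\mathrm{cr}(\phi)$ are the numbers of vertices of total, white, crossing type. $\mathcal{A}(G_m,k)$ is the set of admissible $k$-valuations (every vertex is white or crossing), and $\mathcal{R}(G_m,k)$ is the set of $R$-permissible $k$-valuations (every vertex is white, black or total). $\mathbb{N}$ denotes the positive integers. -}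

module Defs where

open import Level using (Level; 0ℓ; _⊔_)
open import Algebra.Bundles using (CommutativeRing)
open import Algebra.Apartness.Bundles using (HeytingField; HeytingCommutativeRing)
open import Data.Bool.Base using (if_then_else_)
open import Data.Empty using (⊥-elim)
open import Data.Fin.Base as Fin using (Fin; punchIn; punchOut)
open import Data.Fin.Patterns using (0F; 1F; 2F; 3F)
open import Data.Fin.Properties
  using (_≟_; all?; punchOut-cong; punchOut-injective; punchOut-punchIn;
         punchInᵢ≢i; *↔×)
open import Data.Fin.Subset using (Subset; inside; outside; ∣_∣; ⊤)
open import Data.List.Base as List
  using (List; []; _∷_; length; filter; foldr; allFin; cartesianProduct; cartesianProductWith)
open import Data.List.Membership.Propositional using (_∈_)
open import Data.List.Membership.Propositional.Properties
  using (∈-filter⁺; ∈-filter⁻; ∈-cartesianProduct⁺; ∈-map⁺; ∈-allFin)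
open import Data.List.Relation.Unary.Any using (Any; any?; here; there)
open import Data.Nat.Base as ℕ using (ℕ; zero; suc; _∸_; NonZero)
open import Data.Nat.Divisibility using (_∣_; _∣?_)
open import Data.Product.Base using (∃; _×_; _,_; proj₁; proj₂)
open import Data.Product.Properties using (≡-dec)
open import Data.Sum.Base using (_⊎_; inj₁; inj₂)
open import Data.Vec.Base using (Vec; []; _∷_; lookup)
open import Function.Base using (_∘_)
open import Function.Bundles using (Inverse; _↔_)
open import Function.Properties.Inverse using (↔-sym)
open import Relation.Binary.Construct.Closure.Equivalence as Eq using (EqClosure)
open import Relation.Binary.Construct.Closure.ReflexiveTransitive using (ε; _◅_; _◅◅_)
open import Relation.Binary.Construct.Closure.Symmetric using (fwd; bwd)
open import Relation.Binary.Core using (Rel; _⇒_)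
open import Relation.Binary.Definitions using (Decidable)
open import Relation.Binary.PropositionalEquality
  using (_≡_; _≢_; refl; sym; trans; cong; subst)
open import Relation.Nullary using (¬_; Dec; yes; no; ¬?; _×-dec_; _⊎-dec_)
import Relation.Unary as Unary

------------------------------------------------------------------------
-- Quotients of finite types
------------------------------------------------------------------------

-- The set of classes of the equivalence relation generated by _~_, enumerated
-- as Fin size.

record Quotient {A : Set} (_~_ : Rel A 0ℓ) : Set where
  field
    size       : ℕ
    class      : A → Fin size
    surjective : ∀ i → ∃ λ a → class a ≡ i
    sound      : ∀ {a b} → EqClosure _~_ a b → class a ≡ class b
    complete   : ∀ {a b} → class a ≡ class b → EqClosure _~_ a b

-- The remainder of this section shows that a decidable relation on a finite
-- type has such a quotient: starting from the discrete partition, the classes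
-- of a and b are merged for each pair a ~ b in turn.

private
  module Merge {A : Set} where

    Linked : List (A × A) → Rel A 0ℓ
    Linked ps a b = (a , b) ∈ ps

    sound-from : ∀ {R : Rel A 0ℓ} {m} (f : A → Fin m) →
                 (∀ {a b} → R a b → f a ≡ f b) →
                 ∀ {a b} → EqClosure R a b → f a ≡ f b
    sound-from f h ε            = refl
    sound-from f h (fwd r ◅ rs) = trans (h r) (sound-from f h rs)
    sound-from f h (bwd r ◅ rs) = trans (sym (h r)) (sound-from f h rs)

    merge : ∀ {m} (p q : Fin (suc m)) → p ≢ q → Fin (suc m) → Fin m
    merge p q p≢q i with p ≟ i
    ... | yes _  = punchOut p≢q
    ... | no p≢i = punchOut p≢i

    merge-punchIn : ∀ {m} (p q : Fin (suc m)) (p≢q : p ≢ q) j →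
                    merge p q p≢q (punchIn p j) ≡ j
    merge-punchIn p q p≢q j with p ≟ punchIn p j
    ... | yes e = ⊥-elim (punchInᵢ≢i p j (sym e))
    ... | no _  = trans (punchOut-cong p refl) (punchOut-punchIn p)

    merge-glues : ∀ {m} (p q : Fin (suc m)) (p≢q : p ≢ q) →
                  merge p q p≢q p ≡ merge p q p≢q q
    merge-glues p q p≢q with p ≟ p | p ≟ q
    ... | _      | yes e = ⊥-elim (p≢q e)
    ... | yes _  | no _  = punchOut-cong p refl
    ... | no p≢p | no _  = ⊥-elim (p≢p refl)

    merge-kernel : ∀ {m} (p q : Fin (suc m)) (p≢q : p ≢ q) i j →
                   merge p q p≢q i ≡ merge p q p≢q j →
                   i ≡ j ⊎ (p ≡ i × q ≡ j) ⊎ (p ≡ j × q ≡ i)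
    merge-kernel p q p≢q i j e with p ≟ i | p ≟ j
    ... | yes a  | yes b  = inj₁ (trans (sym a) b)
    ... | yes a  | no p≢j = inj₂ (inj₁ (a , punchOut-injective p≢q p≢j e))
    ... | no p≢i | yes b  = inj₂ (inj₂ (b , sym (punchOut-injective p≢i p≢q e)))
    ... | no p≢i | no p≢j = inj₁ (punchOut-injective p≢i p≢j e)

    discrete : ∀ {n} → A ↔ Fin n → Quotient (Linked [])
    discrete {n} A↔n = record
      { size       = n
      ; class      = to
      ; surjective = λ i → from i , strictlyInverseˡ i
      ; sound      = sound-from to λ ()
      ; complete   = λ {a} {b} e → subst (EqClosure _ a)
          (trans (sym (strictlyInverseʳ a)) (trans (cong from e) (strictlyInverseʳ b))) ε
      }
      where open Inverse A↔n

    addPair : ∀ {ps} (a b : A) → Quotient (Linked ps) → Quotient (Linked ((a , b) ∷ ps))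
    addPair {ps} a b Q = go size class surjective sound complete
      where
      open Quotient Q

      weaken : EqClosure (Linked ps) ⇒ EqClosure (Linked ((a , b) ∷ ps))
      weaken = Eq.map there

      link : EqClosure (Linked ((a , b) ∷ ps)) a b
      link = fwd (here refl) ◅ ε

      go : ∀ s (f : A → Fin s) → (∀ i → ∃ λ x → f x ≡ i) →
           (∀ {x y} → EqClosure (Linked ps) x y → f x ≡ f y) →
           (∀ {x y} → f x ≡ f y → EqClosure (Linked ps) x y) →
           Quotient (Linked ((a , b) ∷ ps))
      go zero f _ _ _ with f a
      ... | ()
      go (suc m) f sur snd cmp with f a ≟ f b
      ... | yes e = record
        { size = suc m ; class = f ; surjective = sur
        ; sound    = sound-from f λ { (here refl) → e ; (there r) → snd (fwd r ◅ ε) }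
        ; complete = weaken ∘ cmp
        }
      ... | no fa≢fb = record
        { size       = m
        ; class      = g
        ; surjective = λ i → let x , e = sur (punchIn (f a) i) in
            x , trans (cong (merge (f a) (f b) fa≢fb) e) (merge-punchIn (f a) (f b) fa≢fb i)
        ; sound      = sound-from g λ
            { (here refl) → merge-glues (f a) (f b) fa≢fb
            ; (there r)   → cong (merge (f a) (f b) fa≢fb) (snd (fwd r ◅ ε)) }
        ; complete   = λ {x} {y} e → reflect x y (merge-kernel (f a) (f b) fa≢fb (f x) (f y) e)
        }
        where
        g : A → Fin m
        g = merge (f a) (f b) fa≢fb ∘ f

        reflect : ∀ x y → f x ≡ f y ⊎ (f a ≡ f x × f b ≡ f y) ⊎ (f a ≡ f y × f b ≡ f x) →
                  EqClosure (Linked ((a , b) ∷ ps)) x y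
        reflect x y (inj₁ e) = weaken (cmp e)
        reflect x y (inj₂ (inj₁ (e₁ , e₂))) =
          weaken (cmp (sym e₁)) ◅◅ link ◅◅ weaken (cmp e₂)
        reflect x y (inj₂ (inj₂ (e₁ , e₂))) =
          weaken (cmp (sym e₂)) ◅◅ Eq.symmetric _ link ◅◅ weaken (cmp e₁)

    addPairs : ∀ {n} → A ↔ Fin n → ∀ ps → Quotient (Linked ps)
    addPairs A↔n []             = discrete A↔n
    addPairs A↔n ((a , b) ∷ ps) = addPair a b (addPairs A↔n ps)

quotient : ∀ {A : Set} {n} → A ↔ Fin n → {_~_ : Rel A 0ℓ} → Decidable _~_ → Quotient _~_
quotient {A} {n} A↔n {_~_} _~?_ = record
  { size       = size
  ; class      = class
  ; surjective = surjective
  ; sound      = sound ∘ Eq.map λ {a} {b} r →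
      ∈-filter⁺ related? (∈-cartesianProduct⁺ (listed a) (listed b)) r
  ; complete   = Eq.map (λ p → proj₂ (∈-filter⁻ related? {xs = pairs} p)) ∘ complete
  }
  where
  open Inverse A↔n

  elements : List A
  elements = List.map from (allFin n)

  listed : ∀ a → a ∈ elements
  listed a = subst (_∈ elements) (strictlyInverseʳ a) (∈-map⁺ from (∈-allFin (to a)))

  pairs : List (A × A)
  pairs = cartesianProduct elements elements

  related? : Unary.Decidable λ (p : A × A) → proj₁ p ~ proj₂ p
  related? (a , b) = a ~? b

  open Quotient (Merge.addPairs A↔n (filter related? pairs))

------------------------------------------------------------------------
-- Corners of quadrilaterals
------------------------------------------------------------------------

-- n quadrilaterals, each with its four corners numbered 0,1,2,3 in cyclic
-- order.

Corner : ℕ → Set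
Corner n = Fin n × Fin 4

infix 4 _≟ᶜ_

_≟ᶜ_ : ∀ {n} → Decidable (_≡_ {A = Corner n})
_≟ᶜ_ = ≡-dec _≟_ _≟_

-- One step along one of the given maps; the classes of the generated
-- equivalence are the orbits.

Step : ∀ {n} → List (Corner n → Corner n) → Rel (Corner n) 0ℓ
Step gs x y = Any (λ g → g x ≡ y) gs

step? : ∀ {n} (gs : List (Corner n → Corner n)) → Decidable (Step gs)
step? gs x y = any? (λ g → g x ≟ᶜ y) gs

orbits : ∀ {n} (gs : List (Corner n → Corner n)) → Quotient (Step gs)
orbits {n} gs = quotient (↔-sym *↔×) (step? gs)

#orbits : ∀ {n} → List (Corner n → Corner n) → ℕ
#orbits gs = Quotient.size (orbits gs)

------------------------------------------------------------------------
-- Ribbon graphs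
------------------------------------------------------------------------

-- An edge disc is a quadrilateral: the sides 1–2 and 3–0 are its two ends, the
-- arcs in which it meets the vertex discs; the sides 0–1 and 2–3 are free.
-- The boundary circle of a vertex disc which meets an edge disc is cut by these
-- ends into as many complementary arcs, each joining two corners of edge
-- discs, and arc sends a corner to the other endpoint of the complementary arc
-- starting there.  The vertex discs meeting no edge disc are only counted, by
-- isolated.  No orientation is involved, so every ribbon graph, orientable or
-- not, connected or not, with loops and multiple edges, is described in this
-- way, and every such datum describes a ribbon graph.

record RibbonGraph : Set where
  field
    edges          : ℕ
    isolated       : ℕ
    arc            : Corner edges → Corner edges
    arc-involutive : ∀ x → arc (arc x) ≡ x
    arc-fixfree    : ∀ x → arc x ≢ x

alongSide : Fin 4 → Fin 4
alongSide 0F = 1F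
alongSide 1F = 0F
alongSide 2F = 3F
alongSide 3F = 2F

acrossEnd : Fin 4 → Fin 4
acrossEnd 0F = 3F
acrossEnd 1F = 2F
acrossEnd 2F = 1F
acrossEnd 3F = 0F

module _ {n : ℕ} where

  end : Corner n → Corner n
  end (e , j) = e , acrossEnd j

  sideOn : Subset n → Corner n → Corner n
  sideOn A (e , j) = e , (if lookup A e then alongSide j else j)

  -- At a corner of an edge of A the boundary of the subsurface formed by the
  -- vertex discs and the edge discs of A follows the free side of the edge
  -- disc; where an edge disc is absent it follows the vertex disc, through the
  -- place where the end of the edge disc was.
  boundaryOn : Subset n → Corner n → Corner n
  boundaryOn A (e , j) = e , (if lookup A e then alongSide j else acrossEnd j)

  -- Exchanges the two corners of the end 1–2 of each edge of A.
  swapEnd : Subset n → Corner n → Corner n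
  swapEnd A (e , j) = e , (if lookup A e then swap j else j)
    where
    swap : Fin 4 → Fin 4
    swap 0F = 0F
    swap 1F = 2F
    swap 2F = 1F
    swap 3F = 3F

  swapEnd-involutive : ∀ A x → swapEnd A (swapEnd A x) ≡ x
  swapEnd-involutive A (e , j) with lookup A e
  swapEnd-involutive A (e , j)  | outside = refl
  swapEnd-involutive A (e , 0F) | inside = refl
  swapEnd-involutive A (e , 1F) | inside = refl
  swapEnd-involutive A (e , 2F) | inside = refl
  swapEnd-involutive A (e , 3F) | inside = refl

module _ (G : RibbonGraph) where
  open RibbonGraph G

  -- Number of vertices: the boundary circles of the vertex discs.
  #V : ℕ
  #V = #orbits (arc ∷ end ∷ []) ℕ.+ isolated

  -- The following refer to the spanning ribbon subgraph (V(G),A): its numbers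
  -- of components and of boundary components, its rank and its nullity.

  c : Subset edges → ℕ
  c A = #orbits (arc ∷ end ∷ sideOn A ∷ []) ℕ.+ isolated

  f : Subset edges → ℕ
  f A = #orbits (arc ∷ boundaryOn A ∷ []) ℕ.+ isolated

  r : Subset edges → ℕ
  r A = #V ∸ c A

  n : Subset edges → ℕ
  n A = ∣ A ∣ ∸ r A

  record Plane : Set where
    field
      connected : c ⊤ ≡ 1
      euler     : #V ℕ.+ f ⊤ ≡ edges ℕ.+ 2

-- A half-twist of an edge disc next to its end 1–2 exchanges the two points at
-- which that end's corners sit on the boundary of the vertex disc.

partialPetrial : (G : RibbonGraph) → Subset (RibbonGraph.edges G) → RibbonGraph
partialPetrial G A = record
  { edges          = edges
  ; isolated       = isolated
  ; arc            = swapEnd A ∘ arc ∘ swapEnd A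
  ; arc-involutive = λ x → trans
      (cong (swapEnd A ∘ arc) (swapEnd-involutive A (arc (swapEnd A x))))
      (trans (cong (swapEnd A) (arc-involutive (swapEnd A x))) (swapEnd-involutive A x))
  ; arc-fixfree    = λ x e → arc-fixfree (swapEnd A x)
      (trans (sym (swapEnd-involutive A _)) (cong (swapEnd A) e))
  }
  where open RibbonGraph G

------------------------------------------------------------------------
-- Medial graphs and k-valuations
------------------------------------------------------------------------

-- A checkerboard coloured 4-regular embedded graph, possibly with free loops.
-- The half-edges h₁,h₂,h₃,h₄ at a vertex v are (v , 0),(v , 1),(v , 2),(v , 3),
-- in cyclic order, the corners h₁h₂ and h₃h₄ being white and the corners h₂h₃
-- and h₄h₁ black; mate pairs the two half-edges of an edge.  The embedding is
-- determined by these data, since along each edge black continues as black and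
-- white as white.

record CheckerboardGraph : Set where
  field
    vertices        : ℕ
    freeLoops       : ℕ
    mate            : Corner vertices → Corner vertices
    mate-involutive : ∀ h → mate (mate h) ≡ h
    mate-fixfree    : ∀ h → mate h ≢ h

  #edges : ℕ
  #edges = #orbits (mate ∷ []) ℕ.+ freeLoops

  edgeOf : Corner vertices → Fin #edges
  edgeOf h = Quotient.class (orbits (mate ∷ [])) h Fin.↑ˡ freeLoops

-- The vertex v_e sits in the middle of the edge disc e, its four half-edges
-- leaving towards the corners of e, and an edge of the medial graph runs
-- parallel to each complementary arc of a vertex disc.  The free sides of e lie
-- on faces of G and its ends on vertices of G, so 0–1 and 2–3 are white and
-- 1–2 and 3–0 are black.

medial : RibbonGraph → CheckerboardGraph
medial G = record
  { vertices        = edges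
  ; freeLoops       = isolated
  ; mate            = arc
  ; mate-involutive = arc-involutive
  ; mate-fixfree    = arc-fixfree
  }
  where open RibbonGraph G

-- All words of length n, each once if the letters are distinct.

words : ∀ {A : Set} → List A → (n : ℕ) → List (Vec A n)
words as zero    = [] ∷ []
words as (suc n) = cartesianProductWith _∷_ as (words as n)

subsets : ∀ n → List (Subset n)
subsets = words (outside ∷ inside ∷ [])

module Valuations (M : CheckerboardGraph) (k : ℕ) where
  open CheckerboardGraph M

  Colouring : Set
  Colouring = Vec (Fin k) #edges

  colourings : List Colouring
  colourings = words (allFin k) #edges

  module _ (φ : Colouring) where

    colour : Fin vertices → Fin 4 → Fin k
    colour v j = lookup φ (edgeOf (v , j))

    #half-edges : Fin k → Fin vertices → ℕ
    #half-edges i v = length (filter (λ j → colour v j ≟ i) (allFin 4))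

    Valuation : Set
    Valuation = ∀ i v → 2 ∣ #half-edges i v

    module _ (v : Fin vertices) where

      Total White Black Crossing : Set
      Total    = colour v 0F ≡ colour v 1F × colour v 1F ≡ colour v 2F × colour v 2F ≡ colour v 3F
      White    = ¬ Total × colour v 0F ≡ colour v 1F × colour v 2F ≡ colour v 3F
      Black    = ¬ Total × colour v 1F ≡ colour v 2F × colour v 3F ≡ colour v 0F
      Crossing = ¬ Total × colour v 0F ≡ colour v 2F × colour v 1F ≡ colour v 3F

    Admissible : Set
    Admissible = Valuation × (∀ v → White v ⊎ Crossing v)

    RPermissible : Set
    RPermissible = Valuation × (∀ v → White v ⊎ Black v ⊎ Total v)

    valuation? : Dec Valuation
    valuation? = all? λ i → all? λ v → 2 ∣? #half-edges i v

    total? : Unary.Decidable Total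
    total? v = colour v 0F ≟ colour v 1F ×-dec colour v 1F ≟ colour v 2F
                 ×-dec colour v 2F ≟ colour v 3F

    white? : Unary.Decidable White
    white? v = ¬? (total? v) ×-dec colour v 0F ≟ colour v 1F ×-dec colour v 2F ≟ colour v 3F

    black? : Unary.Decidable Black
    black? v = ¬? (total? v) ×-dec colour v 1F ≟ colour v 2F ×-dec colour v 3F ≟ colour v 0F

    crossing? : Unary.Decidable Crossing
    crossing? v = ¬? (total? v) ×-dec colour v 0F ≟ colour v 2F ×-dec colour v 1F ≟ colour v 3F

    admissible? : Dec Admissible
    admissible? = valuation? ×-dec all? λ v → white? v ⊎-dec crossing? v

    rPermissible? : Dec RPermissible
    rPermissible? = valuation? ×-dec all? λ v → white? v ⊎-dec black? v ⊎-dec total? v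

    tot wh cr : ℕ
    tot = length (filter total? (allFin vertices))
    wh  = length (filter white? (allFin vertices))
    cr  = length (filter crossing? (allFin vertices))

𝓐 : (M : CheckerboardGraph) (k : ℕ) → List (Valuations.Colouring M k)
𝓐 M k = filter (Valuations.admissible? M k) (Valuations.colourings M k)

𝓡 : (M : CheckerboardGraph) (k : ℕ) → List (Valuations.Colouring M k)
𝓡 M k = filter (Valuations.rPermissible? M k) (Valuations.colourings M k)

open Valuations public using (tot; wh; cr)

------------------------------------------------------------------------
-- Polynomials, evaluated in a commutative ring
------------------------------------------------------------------------

module Polynomials {a ℓ : Level} (K : CommutativeRing a ℓ) where
  open CommutativeRing K
  open import Algebra.Properties.Semiring.Exp semiring public using (_^_)

  ∑ : {I : Set} → List I → (I → Carrier) → Carrier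
  ∑ is t = foldr (λ i s → t i + s) 0# is

  -- The exponents below are differences of natural numbers which are never
  -- negative (the last one is the Euler genus of (V(G),A)), so that truncated
  -- subtraction agrees with subtraction.

  R : RibbonGraph → Carrier → Carrier → Carrier → Carrier
  R G x y z = ∑ (subsets (RibbonGraph.edges G)) λ A →
    (x - 1#) ^ (r G ⊤ ∸ r G A) * y ^ n G A * z ^ ((c G A ℕ.+ n G A) ∸ f G A)

  T : RibbonGraph → Carrier → Carrier → Carrier
  T G x y = ∑ (subsets (RibbonGraph.edges G)) λ A →
    (x - 1#) ^ (r G ⊤ ∸ r G A) * (y - 1#) ^ n G A

  P : RibbonGraph → Carrier → Carrier
  P G x = ∑ (subsets (RibbonGraph.edges G)) λ A →
    (- 1#) ^ ∣ A ∣ * x ^ f (partialPetrial G A) ⊤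

------------------------------------------------------------------------
-- Fields of characteristic zero
------------------------------------------------------------------------

-- Constructively "nonzero" is apartness from 0, as for the complex numbers.

module Field {a ℓ₁ ℓ₂ : Level} (K : HeytingField a ℓ₁ ℓ₂) where
  open HeytingField K

  commutativeRing : CommutativeRing a ℓ₁
  commutativeRing = HeytingCommutativeRing.commutativeRing heytingCommutativeRing

  open Polynomials commutativeRing public
  open import Algebra.Properties.Semiring.Mult
    (CommutativeRing.semiring commutativeRing) using () renaming (_×_ to _·_)

  ⟦_⟧ : ℕ → Carrier
  ⟦ m ⟧ = m · 1#

  CharacteristicZero : Set ℓ₂
  CharacteristicZero = ∀ m → .{{NonZero m}} → ⟦ m ⟧ # 0#

  -- The library provides an inverse of y - 0#.
  _/_[_] : (x y : Carrier) → y # 0# → Carrier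
  x / y [ y#0 ] = x * proj₁ (#⇒invertible y#0)

{-# OPTIONS --safe #-}

-- k^f(A) counts the k-colourings of the medial edges that are constant along
-- the boundary of (V(G),A): at v_e they agree along the sides of the edge disc
-- e if e ∈ A, and across its ends otherwise.  Hence ∑_A w^|A| k^f(A) is a sum
-- over all colourings of a product of local weights, w [agree along] + [agree
-- across], which vanishes unless every vertex is white, black or total.  The
-- Penrose polynomial is a sum of the same kind, in which opposite half-edges
-- agree if e ∈ A, because a half-twist turns the sides of e into its diagonals,
-- and half-edges agree along the sides of e otherwise.
-- R and T reduce to ∑_A b^|A| k^f(A) by counting exponents.  The exponent of z
-- is the Euler genus of (V(G),A), which increases with A: a new edge raises f
-- by at most 1, and merges two boundary components if it joins two components.
-- So it is never negative, and it vanishes throughout if G is plane.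

module Submission where

open import Defs
open import Level using (0ℓ)
open import Algebra.Apartness.Bundles using (HeytingField)
open import Algebra.Bundles using (CommutativeRing)
open import Data.Bool.Base using (Bool; true; false; if_then_else_)
open import Data.Fin.Base as Fin using (Fin; zero; suc; splitAt; _↑ˡ_; _↑ʳ_)
open import Data.Fin.Patterns using (0F; 1F; 2F; 3F)
open import Data.Fin.Permutation using (permutation)
open import Data.Fin.Properties
  using (_≟_; _<?_; <-cmp; <-asym; <-irrefl; suc-injective; injective⇒≤; *↔×; all?; ¬∀⟶∃¬;
         splitAt-↑ˡ; splitAt-↑ʳ; splitAt⁻¹-↑ˡ; splitAt⁻¹-↑ʳ; splitAt-join)
open import Data.Fin.Subset using (Subset; inside; outside; ∣_∣; ⊤; ⊥)
open import Data.Fin.Subset.Properties using (∣⊥∣≡0; ∣⊤∣≡n)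
open import Data.List.Base as List using (List; []; _∷_; _++_; length; filter; allFin; map)
open import Data.List.Membership.Propositional using (_∈_)
open import Data.List.Membership.Propositional.Properties
  using (∈-filter⁺; ∈-filter⁻; ∈-map⁺; ∈-map⁻; ∈-allFin; ∈-cartesianProductWith⁺)
open import Data.List.Membership.Propositional.Properties.WithK using (unique∧set⇒bag)
open import Data.List.Properties using (length-map; length-++; length-tabulate)
open import Data.List.Relation.Binary.BagAndSetEquality using (∼bag⇒↭)
open import Data.List.Relation.Binary.Permutation.Propositional.Properties using (↭-length)
open import Data.List.Relation.Unary.All using (All; []; _∷_)
open import Data.List.Relation.Unary.AllPairs using ([]; _∷_)
open import Data.List.Relation.Unary.Any as Any using (here; there)
open import Data.List.Relation.Unary.Unique.Propositional using (Unique)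
import Data.List.Relation.Unary.Unique.Propositional.Properties as Unique
open import Data.Nat.Base as ℕ using (ℕ; zero; suc; _∸_; NonZero)
open import Data.Nat.Divisibility using (_∣_; divides; ∣1⇒≡1; ∣m+n∣m⇒∣n)
import Data.Nat.Properties as ℕ
open import Data.Nat.Solver using (module +-*-Solver)
open import Data.Product.Base using (∃; _×_; _,_; proj₁; proj₂)
open import Data.Sum.Base as Sum using (_⊎_; inj₁; inj₂)
open import Data.Sum.Properties using (inj₁-injective; inj₂-injective)
open import Data.Vec.Base using (Vec; []; _∷_; lookup; tabulate)
open import Data.Vec.Properties
  using (∷-injective; lookup∘tabulate; tabulate∘lookup; tabulate-cong; lookup-replicate)
open import Function.Base using (_∘_; id)
open import Function.Bundles using (Inverse; mk⇔)
open import Relation.Binary.Construct.Closure.Equivalence as Eq using (EqClosure)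
open import Relation.Binary.Construct.Closure.ReflexiveTransitive using (Star; ε; _◅_; _◅◅_; gmap)
open import Relation.Binary.Construct.Closure.Symmetric using (fwd; bwd)
open import Relation.Binary.Core using (Rel; _⇒_)
open import Relation.Binary.Definitions using (tri<; tri≈; tri>)
open import Relation.Binary.PropositionalEquality as ≡ using (_≡_; _≢_)
open import Relation.Nullary
  using (¬_; Dec; yes; no; does; contradiction; decidable-stable; _⊎-dec_)
open import Relation.Nullary.Decidable using (does-⇔; dec-true)
import Relation.Unary as Unary

module Combinatorics where
  open import Data.Nat.Base using (_+_; _*_; _^_; _≤_)
  open import Relation.Binary.PropositionalEquality
    using (refl; sym; trans; cong; cong₂; subst; isEquivalence; module ≡-Reasoning)
  open import Algebra.Properties.CommutativeMonoid.Sum ℕ.+-0-commutativeMonoid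
    using (sum; sum-cong-≗; ∑-distrib-+; ∑-permute; sum-replicate-zero)

  -- Sizes of quotients

  module _ {A : Set} {R : Rel A 0ℓ} (Q : Quotient R) where
    open Quotient Q

    representative : Fin size → A
    representative i = proj₁ (surjective i)

    class-representative : ∀ i → class (representative i) ≡ i
    class-representative i = proj₂ (surjective i)

    related? : ∀ x y → Dec (EqClosure R x y)
    related? x y with class x ≟ class y
    ... | yes e = yes (complete e)
    ... | no ¬e = no (¬e ∘ sound)

  module _ {A B : Set} {R : Rel A 0ℓ} {S : Rel B 0ℓ} (Q : Quotient R) (Q′ : Quotient S) where
    private
      module Q = Quotient Q
      module Q′ = Quotient Q′

    -- Each class of `S` is sent to the class of the image of its representative, and reflection of
    -- the relation makes this injective. Equalities of orbit numbers come from applying it in both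
    -- directions.
    size-≤ : (s : B → A) → (∀ {x y} → EqClosure R (s x) (s y) → EqClosure S x y) →
             Q′.size ≤ Q.size
    size-≤ s reflects = injective⇒≤ {f = Q.class ∘ s ∘ representative Q′} λ {i} {j} e →
      trans (sym (class-representative Q′ i))
        (trans (Q′.sound (reflects (Q.complete e))) (class-representative Q′ j))

  Adjoin : ∀ {A : Set} → Rel A 0ℓ → A → A → Rel A 0ℓ
  Adjoin R a b x y = R x y ⊎ (x ≡ a × y ≡ b)

  -- Two crossings of the adjoined pair only lead back into the class of `a` or of `b`, so a path
  -- can be shortened to one that crosses it at most once.
  adjoin-kernel : ∀ {A : Set} {R : Rel A 0ℓ} {a b x y} → EqClosure (Adjoin R a b) x y →
                  EqClosure R x y ⊎
                  (EqClosure R x a × EqClosure R y b) ⊎ (EqClosure R x b × EqClosure R y a)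
  adjoin-kernel ε = inj₁ ε
  adjoin-kernel {R = R} (fwd (inj₁ p) ◅ ps) =
    Sum.map (fwd p ◅_) (Sum.map (λ (u , v) → fwd p ◅ u , v) (λ (u , v) → fwd p ◅ u , v))
      (adjoin-kernel ps)
  adjoin-kernel {R = R} (bwd (inj₁ p) ◅ ps) =
    Sum.map (bwd p ◅_) (Sum.map (λ (u , v) → bwd p ◅ u , v) (λ (u , v) → bwd p ◅ u , v))
      (adjoin-kernel ps)
  adjoin-kernel {R = R} (fwd (inj₂ (refl , refl)) ◅ ps) with adjoin-kernel ps
  ... | inj₁ u              = inj₂ (inj₁ (ε , Eq.symmetric R u))
  ... | inj₂ (inj₁ (u , v)) = inj₂ (inj₁ (ε , v))
  ... | inj₂ (inj₂ (u , v)) = inj₁ (Eq.symmetric R v)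
  adjoin-kernel {R = R} (bwd (inj₂ (refl , refl)) ◅ ps) with adjoin-kernel ps
  ... | inj₁ u              = inj₂ (inj₂ (ε , Eq.symmetric R u))
  ... | inj₂ (inj₁ (u , v)) = inj₁ (Eq.symmetric R v)
  ... | inj₂ (inj₂ (u , v)) = inj₂ (inj₂ (ε , v))

  module _ {A : Set} {R S : Rel A 0ℓ} (Q : Quotient R) (Q′ : Quotient S) where
    private
      module Q = Quotient Q
      module Q′ = Quotient Q′

    -- Only the classes of `a` and `b` can have been merged. With the class of `a` sent to the extra
    -- element `zero`, the other classes of `R` stay apart in `S`.
    size-adjoin : ∀ {a b} → EqClosure S ⇒ EqClosure (Adjoin R a b) → Q.size ≤ suc Q′.size
    size-adjoin {a} {b} S⊆ = injective⇒≤ {f = λ i → h i (Q.class a ≟ i)} λ {i} {j} →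
      inj i j (Q.class a ≟ i) (Q.class a ≟ j)
      where
      h : ∀ i → Dec (Q.class a ≡ i) → Fin (suc Q′.size)
      h i (yes _) = zero
      h i (no _)  = suc (Q′.class (representative Q i))

      inj : ∀ i j d d′ → h i d ≡ h j d′ → i ≡ j
      inj i j (yes p) (yes q) e = trans (sym p) q
      inj i j (no ¬p) (no ¬q) e with adjoin-kernel (S⊆ (Q′.complete (suc-injective e)))
      ... | inj₁ u = trans (sym (class-representative Q i))
        (trans (Q.sound u) (class-representative Q j))
      ... | inj₂ (inj₁ (u , _)) =
        contradiction (trans (sym (Q.sound u)) (class-representative Q i)) ¬p
      ... | inj₂ (inj₂ (_ , v)) =
        contradiction (trans (sym (Q.sound v)) (class-representative Q j)) ¬q

    size-< : EqClosure R ⇒ EqClosure S →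
             ∀ {a b} → EqClosure S a b → ¬ EqClosure R a b → suc Q′.size ≤ Q.size
    size-< R⊆S {a} {b} ab ¬ab = injective⇒≤ {f = h} λ {i} {j} → inj i j
      where
      -- The merged class is represented by b, so that the class of a is missed.
      g : ∀ i → Dec (Q′.class a ≡ i) → A
      g i (yes _) = b
      g i (no _)  = representative Q′ i

      class-g : ∀ i d → Q′.class (g i d) ≡ i
      class-g i (yes e) = trans (sym (Q′.sound ab)) e
      class-g i (no _)  = class-representative Q′ i

      g-avoids : ∀ i d → Q.class a ≢ Q.class (g i d)
      g-avoids i (yes _) e = ¬ab (Q.complete e)
      g-avoids i (no ¬p) e = ¬p (trans (Q′.sound (R⊆S (Q.complete e))) (class-representative Q′ i))

      h : Fin (suc Q′.size) → Fin Q.size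
      h zero    = Q.class a
      h (suc i) = Q.class (g i (Q′.class a ≟ i))

      inj : ∀ i j → h i ≡ h j → i ≡ j
      inj zero    zero    _ = refl
      inj zero    (suc j) e = contradiction e (g-avoids j (Q′.class a ≟ j))
      inj (suc i) zero    e = contradiction (sym e) (g-avoids i (Q′.class a ≟ i))
      inj (suc i) (suc j) e = cong suc (trans (sym (class-g i (Q′.class a ≟ i)))
        (trans (Q′.sound (R⊆S (Q.complete e))) (class-g j (Q′.class a ≟ j))))

  module _ {n : ℕ} {gs : List (Corner n → Corner n)} where

    step : ∀ {g} → g ∈ gs → ∀ x → EqClosure (Step gs) x (g x)
    step g∈gs x = Eq.return (Any.map (λ { refl → refl }) g∈gs)

    -- The orbits are generated by single steps, so only the generators have to be checked.
    orbit-map : ∀ {A : Set} {S : Rel A 0ℓ} (s : Corner n → A) →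
                All (λ g → ∀ x → EqClosure S (s x) (s (g x))) gs →
                ∀ {x y} → EqClosure (Step gs) x y → EqClosure S (s x) (s y)
    orbit-map {S = S} s hs = Eq.gfold (Eq.isEquivalence S) s (along hs)
      where
      along : ∀ {hs x y} → All (λ g → ∀ x → EqClosure S (s x) (s (g x))) hs →
              Step hs x y → EqClosure S (s x) (s y)
      along (h ∷ _)  (here refl) = h _
      along (_ ∷ hs) (there r)   = along hs r

  -- Fixed points of involutions

  𝟙 : ∀ {P : Set} → Dec P → ℕ
  𝟙 (yes _) = 1
  𝟙 (no _)  = 0

  𝟙-cong : ∀ {P Q : Set} (P? : Dec P) (Q? : Dec Q) → (P → Q) → (Q → P) → 𝟙 P? ≡ 𝟙 Q?
  𝟙-cong (yes p) (yes q) f g = refl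
  𝟙-cong (yes p) (no ¬q) f g = contradiction (f p) ¬q
  𝟙-cong (no ¬p) (yes q) f g = contradiction (g q) ¬p
  𝟙-cong (no ¬p) (no ¬q) f g = refl

  sum-𝟙 : ∀ {N} (i : Fin N) → sum (λ j → 𝟙 (i ≟ j)) ≡ 1
  sum-𝟙 {suc N} zero    = cong suc (sum-replicate-zero N)
  sum-𝟙 {suc N} (suc i) =
    trans (sum-cong-≗ λ j → 𝟙-cong (suc i ≟ suc j) (i ≟ j) suc-injective (cong suc)) (sum-𝟙 i)

  module _ {N} (X : Fin N → Bool) (g : Fin N → Fin N) (g-inv : ∀ x → g (g x) ≡ x)
           (X-stable : ∀ x → X (g x) ≡ X x) where

    below fixed : Fin N → ℕ
    below x = if X x then 𝟙 (x <? g x) else 0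
    fixed x = if X x then 𝟙 (g x ≟ x) else 0

    -- An orbit of two points is counted once at its smaller point by `below` and once at its larger
    -- point by `below ∘ g`. Reindexing along `g` makes these two sums equal.
    card-involution : sum (λ x → if X x then 1 else 0) ≡ (sum below + sum below) + sum fixed
    card-involution = begin
      sum (λ x → if X x then 1 else 0)
        ≡⟨ sum-cong-≗ split ⟩
      sum (λ x → (below x + below (g x)) + fixed x)
        ≡⟨ ∑-distrib-+ (λ x → below x + below (g x)) fixed ⟩
      sum (λ x → below x + below (g x)) + sum fixed
        ≡⟨ cong (_+ sum fixed) (∑-distrib-+ below (below ∘ g)) ⟩
      (sum below + sum (below ∘ g)) + sum fixed
        ≡⟨ cong (λ s → (sum below + s) + sum fixed)
             (∑-permute below (permutation g g g-inv g-inv)) ⟨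
      (sum below + sum below) + sum fixed ∎
      where
      open ≡-Reasoning
      split : ∀ x → (if X x then 1 else 0) ≡ (below x + below (g x)) + fixed x
      split x rewrite X-stable x | g-inv x with X x
      ... | false = refl
      ... | true with x <? g x | g x <? x | g x ≟ x
      ...   | yes _ | no _  | no _  = refl
      ...   | no _  | yes _ | no _  = refl
      ...   | no _  | no _  | yes _ = refl
      ...   | yes p | yes q | _     = contradiction q (<-asym p)
      ...   | yes p | no _  | yes e = contradiction p (<-irrefl (sym e))
      ...   | no _  | yes q | yes e = contradiction q (<-irrefl e)
      ...   | no ¬p | no ¬q | no ¬e with <-cmp x (g x)
      ...     | tri< p _ _ = contradiction p ¬p
      ...     | tri≈ _ e _ = contradiction (sym e) ¬e
      ...     | tri> _ _ q = contradiction q ¬q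

  -- The two involutions determine the parity of |X| in two ways.
  ¬unique-fixed : ∀ {N} (X : Fin N → Bool) (g h : Fin N → Fin N) →
                  (∀ x → g (g x) ≡ x) → (∀ x → h (h x) ≡ x) →
                  (∀ x → X (g x) ≡ X x) → (∀ x → X (h x) ≡ X x) →
                  (∀ x → g x ≢ x) →
                  ∀ x₀ → X x₀ ≡ true → h x₀ ≡ x₀ →
                  ¬ (∀ x → X x ≡ true → h x ≡ x → x₀ ≡ x)
  ¬unique-fixed {N} X g h gg hh Xg Xh g≢ x₀ Xx₀ hx₀ unique =
    -- The fixed-point-free `g` makes the size of `X` even and the single fixed point of `h` makes
    -- it odd, which would leave 2 dividing 1.
    contradiction (∣1⇒≡1 (∣m+n∣m⇒∣n (subst (2 ∣_) card-by-h even-by-g) (2∣m+m below-h))) λ ()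
    where
    below-g = sum (below X g gg Xg)
    below-h = sum (below X h hh Xh)

    2∣m+m : ∀ m → 2 ∣ m + m
    2∣m+m m = divides m (trans (cong (m +_) (sym (ℕ.+-identityʳ m))) (ℕ.*-comm 2 m))

    fixed-g : ∀ x → fixed X g gg Xg x ≡ 0
    fixed-g x with X x
    ... | false = refl
    ... | true with g x ≟ x
    ...   | yes e = contradiction e (g≢ x)
    ...   | no _  = refl

    even-by-g : 2 ∣ sum (λ x → if X x then 1 else 0)
    even-by-g = subst (2 ∣_)
      (sym (trans (card-involution X g gg Xg)
        (trans (cong (below-g + below-g +_) (trans (sum-cong-≗ fixed-g) (sum-replicate-zero N)))
          (ℕ.+-identityʳ (below-g + below-g)))))
      (2∣m+m below-g)

    fixed-h : ∀ x → fixed X h hh Xh x ≡ 𝟙 (x₀ ≟ x)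
    fixed-h x with X x in Xx
    ... | true = 𝟙-cong (h x ≟ x) (x₀ ≟ x) (unique x Xx) λ { refl → hx₀ }
    ... | false with x₀ ≟ x
    ...   | no _ = refl
    ...   | yes refl with () ← trans (sym Xx₀) Xx

    card-by-h : sum (λ x → if X x then 1 else 0) ≡ (below-h + below-h) + 1
    card-by-h = trans (card-involution X h hh Xh)
      (cong (below-h + below-h +_) (trans (sum-cong-≗ fixed-h) (sum-𝟙 x₀)))

  -- Adding an edge to a spanning subgraph

  infix 4 _⋖_

  data _⋖_ : ∀ {n} → Subset n → Subset n → Set where
    here  : ∀ {n} {A : Subset n} → outside ∷ A ⋖ inside ∷ A
    there : ∀ {n s} {A B : Subset n} → A ⋖ B → s ∷ A ⋖ s ∷ B

  ⊥⋖* : ∀ {n} (A : Subset n) → Star _⋖_ ⊥ A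
  ⊥⋖* []            = ε
  ⊥⋖* (outside ∷ A) = gmap (outside ∷_) there (⊥⋖* A)
  ⊥⋖* (inside ∷ A)  = here ◅ gmap (inside ∷_) there (⊥⋖* A)

  ⋖*⊤ : ∀ {n} (A : Subset n) → Star _⋖_ A ⊤
  ⋖*⊤ []            = ε
  ⋖*⊤ (outside ∷ A) = here ◅ gmap (inside ∷_) there (⋖*⊤ A)
  ⋖*⊤ (inside ∷ A)  = gmap (inside ∷_) there (⋖*⊤ A)

  ∣⋖∣ : ∀ {n} {A B : Subset n} → A ⋖ B → ∣ B ∣ ≡ suc ∣ A ∣
  ∣⋖∣ here                  = refl
  ∣⋖∣ (there {s = outside} p) = ∣⋖∣ p
  ∣⋖∣ (there {s = inside} p)  = cong suc (∣⋖∣ p)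

  record AddedAt {n} (A B : Subset n) (e : Fin n) : Set where
    field
      before : lookup A e ≡ outside
      after  : lookup B e ≡ inside
      away   : ∀ {e′} → e′ ≢ e → lookup A e′ ≡ lookup B e′

  added : ∀ {n} {A B : Subset n} → A ⋖ B → ∃ (AddedAt A B)
  added here = zero , record
    { before = refl
    ; after  = refl
    ; away   = λ { {zero} e≢ → contradiction refl e≢ ; {suc _} _ → refl }
    }
  added (there p) with added p
  ... | e , q = suc e , record
    { before = AddedAt.before q
    ; after  = AddedAt.after q
    ; away   = λ { {zero} _ → refl ; {suc _} e≢ → AddedAt.away q (e≢ ∘ cong suc) }
    }

  -- Involutions on the corners of an edge disc

  alongSide-involutive : ∀ j → alongSide (alongSide j) ≡ j
  alongSide-involutive 0F = refl
  alongSide-involutive 1F = refl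
  alongSide-involutive 2F = refl
  alongSide-involutive 3F = refl

  acrossEnd-involutive : ∀ j → acrossEnd (acrossEnd j) ≡ j
  acrossEnd-involutive 0F = refl
  acrossEnd-involutive 1F = refl
  acrossEnd-involutive 2F = refl
  acrossEnd-involutive 3F = refl

  alongSide-fixfree : ∀ j → alongSide j ≢ j
  alongSide-fixfree 0F ()
  alongSide-fixfree 1F ()
  alongSide-fixfree 2F ()
  alongSide-fixfree 3F ()

  acrossEnd-fixfree : ∀ j → acrossEnd j ≢ j
  acrossEnd-fixfree 0F ()
  acrossEnd-fixfree 1F ()
  acrossEnd-fixfree 2F ()
  acrossEnd-fixfree 3F ()

  boundaryOn-involutive : ∀ {n} (A : Subset n) x → boundaryOn A (boundaryOn A x) ≡ x
  boundaryOn-involutive A (e , j) with lookup A e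
  ... | inside  = cong (e ,_) (alongSide-involutive j)
  ... | outside = cong (e ,_) (acrossEnd-involutive j)

  boundaryOn-fixfree : ∀ {n} (A : Subset n) x → boundaryOn A x ≢ x
  boundaryOn-fixfree A (e , j) eq with lookup A e
  ... | inside  = alongSide-fixfree j (cong proj₂ eq)
  ... | outside = acrossEnd-fixfree j (cong proj₂ eq)

  from-does : ∀ {P : Set} (P? : Dec P) → does P? ≡ true → P
  from-does (yes p) _ = p

  -- Components and boundary components when an edge is added

  module _ (G : RibbonGraph) where
    open RibbonGraph G renaming (edges to m)

    VertexStep : Rel (Corner m) 0ℓ
    VertexStep = Step (arc ∷ end ∷ [])

    ComponentStep FaceStep : Subset m → Rel (Corner m) 0ℓ
    ComponentStep A = Step (arc ∷ end ∷ sideOn A ∷ [])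
    FaceStep A = Step (arc ∷ boundaryOn A ∷ [])

    -- The boundary follows a side at an edge of `A` and an end elsewhere, and neither leaves the
    -- component.
    face⊆component : ∀ A → EqClosure (FaceStep A) ⇒ EqClosure (ComponentStep A)
    face⊆component A = orbit-map id (step (here refl) ∷ boundary ∷ [])
      where
      boundary : ∀ x → EqClosure (ComponentStep A) x (boundaryOn A x)
      -- The step along `sideOn A` is abstracted together with `lookup A e`, so that its endpoint
      -- reduces in each branch.
      boundary (e , j) with lookup A e
        | step {gs = arc ∷ end ∷ sideOn A ∷ []} (there (there (here refl))) (e , j)
      ... | inside  | p = p
      ... | outside | _ = step (there (here refl)) (e , j)

    module EdgeAdded {A B : Subset m} {e : Fin m} (A+e : AddedAt A B e) where
      open AddedAt A+e

      components-A⊆B : EqClosure (ComponentStep A) ⇒ EqClosure (ComponentStep B)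
      components-A⊆B = orbit-map id
        (step (here refl) ∷ step (there (here refl)) ∷ side ∷ [])
        where
        side : ∀ x → EqClosure (ComponentStep B) x (sideOn A x)
        side (e′ , j) with e′ ≟ e
        ... | yes refl rewrite before = ε
        ... | no e≢ rewrite away e≢ = step (there (there (here refl))) (e′ , j)

      -- The only new links are the two sides of `e`, and the ends of `e` turn the link 0-1 into the
      -- link 2-3. `S` is general so that it can be the relation of `A` itself or that relation with
      -- one pair adjoined.
      components-B⊆ : ∀ {S} → EqClosure (ComponentStep A) ⇒ EqClosure S →
                      EqClosure S (e , 0F) (e , 1F) → EqClosure (ComponentStep B) ⇒ EqClosure S
      components-B⊆ {S} A⊆S e₀₁ = orbit-map id
        (A⊆S ∘ step (here refl) ∷ across ∷ side ∷ [])
        where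
        across : ∀ x → EqClosure S x (end x)
        across = A⊆S ∘ step (there (here refl))

        e₂₃ : EqClosure S (e , 2F) (e , 3F)
        e₂₃ = across (e , 2F) ◅◅ Eq.symmetric S e₀₁ ◅◅ across (e , 0F)

        side : ∀ x → EqClosure S x (sideOn B x)
        side (e′ , j) with e′ ≟ e
        side (e′ , j)  | no e≢ rewrite sym (away e≢) =
          A⊆S (step (there (there (here refl))) (e′ , j))
        side (e′ , 0F) | yes refl rewrite after = e₀₁
        side (e′ , 1F) | yes refl rewrite after = Eq.symmetric S e₀₁
        side (e′ , 2F) | yes refl rewrite after = e₂₃
        side (e′ , 3F) | yes refl rewrite after = Eq.symmetric S e₂₃

      -- The comparison passes through the orbits `J` of both boundary maps together, of which there
      -- are at most as many as faces of `A`. Over the faces of `B` they add only the links 0-3 and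
      -- 1-2 at `e`, and the sides of `e` derive the second from the first, so a single adjoined
      -- pair suffices.
      faces-≤ : f G B ≤ suc (f G A)
      faces-≤ = ℕ.+-monoˡ-≤ isolated (ℕ.≤-trans
        (size-adjoin (orbits (arc ∷ boundaryOn B ∷ [])) J J⊆)
        (ℕ.s≤s (size-≤ (orbits (arc ∷ boundaryOn A ∷ [])) J id
          (orbit-map id (step (here refl) ∷ step (there (here refl)) ∷ [])))))
        where
        J = orbits (arc ∷ boundaryOn A ∷ boundaryOn B ∷ [])

        S = Adjoin (FaceStep B) (e , 0F) (e , 3F)

        boundaryB : ∀ x → EqClosure S x (boundaryOn B x)
        boundaryB x = Eq.map inj₁ (step (there (here refl)) x)

        along : ∀ j → EqClosure S (e , j) (e , alongSide j)
        along j = subst (λ s → EqClosure S (e , j) (e , (if s then alongSide j else acrossEnd j)))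
          after (boundaryB (e , j))

        e₀₃ : EqClosure S (e , 0F) (e , 3F)
        e₀₃ = Eq.return (inj₂ (refl , refl))

        e₁₂ : EqClosure S (e , 1F) (e , 2F)
        e₁₂ = along 1F ◅◅ e₀₃ ◅◅ along 3F

        boundaryA : ∀ x → EqClosure S x (boundaryOn A x)
        boundaryA (e′ , j) with e′ ≟ e
        boundaryA (e′ , j)  | no e≢ rewrite away e≢ = boundaryB (e′ , j)
        boundaryA (e′ , 0F) | yes refl rewrite before = e₀₃
        boundaryA (e′ , 1F) | yes refl rewrite before = e₁₂
        boundaryA (e′ , 2F) | yes refl rewrite before = Eq.symmetric S e₁₂
        boundaryA (e′ , 3F) | yes refl rewrite before = Eq.symmetric S e₀₃

        J⊆ : EqClosure (Step (arc ∷ boundaryOn A ∷ boundaryOn B ∷ [])) ⇒ EqClosure S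
        J⊆ = orbit-map id
          ((λ x → Eq.map inj₁ (step (here refl) x)) ∷ boundaryA ∷ boundaryB ∷ [])

      -- The orbits of arc and detour are the boundary arcs left when the
      -- boundary components are cut at the four corners of e.
      detour : Corner m → Corner m
      detour x with proj₁ x ≟ e
      ... | yes _ = x
      ... | no _  = boundaryOn A x

      detour-involutive : ∀ x → detour (detour x) ≡ x
      detour-involutive x with proj₁ x ≟ e in eq
      ... | yes _ rewrite eq = refl
      ... | no _ rewrite eq = boundaryOn-involutive A x

      detour-fixed : ∀ x → detour x ≡ x → proj₁ x ≡ e
      detour-fixed x fix with proj₁ x ≟ e
      ... | yes p = p
      ... | no _  = contradiction fix (boundaryOn-fixfree A x)

      detour-at : ∀ j → detour (e , j) ≡ (e , j)
      detour-at j with e ≟ e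
      ... | yes _ = refl
      ... | no ¬p = contradiction refl ¬p

      ArcStep : Rel (Corner m) 0ℓ
      ArcStep = Step (arc ∷ detour ∷ [])

      arc? : ∀ x y → Dec (EqClosure ArcStep x y)
      arc? = related? (orbits (arc ∷ detour ∷ []))

      -- A boundary arc has two endpoints. On its class `arc` fixes nothing and `detour` fixes
      -- exactly the corners of `e`, so by parity it cannot meet these in one corner only. The
      -- corners are numbered by `*↔×` to make them countable.
      ¬lone-corner : ∀ j → ¬ (∀ j′ → EqClosure ArcStep (e , j) (e , j′) → j ≡ j′)
      ¬lone-corner j lone =
        ¬unique-fixed X (from ∘ arc ∘ to) (from ∘ detour ∘ to)
          (involutive arc arc-involutive) (involutive detour detour-involutive)
          (stable (here refl)) (stable (there (here refl)))
          (λ i fix → arc-fixfree (to i) (trans (sym (strictlyInverseˡ _)) (cong to fix)))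
          (from (e , j))
          (dec-true (arc? (e , j) _) (subst (EqClosure ArcStep _) (sym (strictlyInverseˡ _)) ε))
          (cong from (trans (cong detour (strictlyInverseˡ _)) (detour-at j)))
          (λ i Xi fix → unique i (to i) refl (from-does (arc? _ _) Xi)
            (trans (sym (strictlyInverseˡ _)) (cong to fix)))
        where
        open Inverse (*↔× {m} {4})

        X : Fin (m * 4) → Bool
        X i = does (arc? (e , j) (to i))

        involutive : ∀ (g : Corner m → Corner m) → (∀ x → g (g x) ≡ x) →
                     ∀ i → from (g (to (from (g (to i))))) ≡ i
        involutive g gg i = trans (cong (from ∘ g) (strictlyInverseˡ _))
          (trans (cong from (gg (to i))) (strictlyInverseʳ i))

        stable : ∀ {g} → Any.Any (g ≡_) (arc ∷ detour ∷ []) → ∀ i → X (from (g (to i))) ≡ X i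
        stable {g} g∈ i = does-⇔
          (mk⇔ (λ p → subst (EqClosure ArcStep _) (strictlyInverseˡ _) p ◅◅ Eq.symmetric _ (step g∈ (to i)))
               (λ p → subst (EqClosure ArcStep _) (sym (strictlyInverseˡ _)) (p ◅◅ step g∈ (to i))))
          (arc? (e , j) (to (from (g (to i))))) (arc? (e , j) (to i))

        unique : ∀ i x → to i ≡ x → EqClosure ArcStep (e , j) x → detour x ≡ x → from (e , j) ≡ i
        unique i (e′ , j′) to-i r fix with refl ← detour-fixed (e′ , j′) fix =
          trans (cong (λ j → from (e , j)) (lone j′ r)) (trans (cong from (sym to-i)) (strictlyInverseʳ i))

      arc⊆component : EqClosure ArcStep ⇒ EqClosure (ComponentStep A)
      arc⊆component = orbit-map id (step (here refl) ∷ around ∷ [])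
        where
        around : ∀ x → EqClosure (ComponentStep A) x (detour x)
        around x with proj₁ x ≟ e
        ... | yes _ = ε
        ... | no _  = face⊆component A (step (there (here refl)) x)

      -- Away from `e` the boundaries for `A` and `B` coincide.
      arc⊆faceB : EqClosure ArcStep ⇒ EqClosure (FaceStep B)
      arc⊆faceB = orbit-map id (step (here refl) ∷ around ∷ [])
        where
        around : ∀ x → EqClosure (FaceStep B) x (detour x)
        around x with proj₁ x ≟ e
        ... | yes _ = ε
        ... | no e≢ rewrite away e≢ = step (there (here refl)) x

      -- An edge joining two components runs between two boundary components.
      faces-< : ¬ EqClosure (ComponentStep A) (e , 0F) (e , 1F) → suc (f G B) ≤ f G A
      faces-< ¬e₀₁ = ℕ.+-monoˡ-≤ isolated
        (size-< (orbits (arc ∷ boundaryOn A ∷ [])) (orbits (arc ∷ boundaryOn B ∷ []))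
          (orbit-map id (step (here refl) ∷ boundaryA ∷ []))
          e₀₁ (¬e₀₁ ∘ face⊆component A))
        where
        across : ∀ x → EqClosure (ComponentStep A) x (end x)
        across = step (there (here refl))

        -- The boundary arc leaving corner 0 ends at another corner of `e`. Corners 1 and 2 lie in a
        -- different component of `A`, so it ends at 3; likewise the arc from 1 ends at 2.
        e₀₃ : EqClosure ArcStep (e , 0F) (e , 3F)
        e₀₃ = decidable-stable (arc? _ _) λ ¬e₀₃ → ¬lone-corner 0F λ
          { 0F _ → refl
          ; 1F r → contradiction (arc⊆component r) ¬e₀₁
          ; 2F r → contradiction (arc⊆component r ◅◅ across (e , 2F)) ¬e₀₁
          ; 3F r → contradiction r ¬e₀₃
          }

        e₁₂ : EqClosure ArcStep (e , 1F) (e , 2F)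
        e₁₂ = decidable-stable (arc? _ _) λ ¬e₁₂ → ¬lone-corner 1F λ
          { 0F r → contradiction (Eq.symmetric _ (arc⊆component r)) ¬e₀₁
          ; 1F _ → refl
          ; 2F r → contradiction r ¬e₁₂
          ; 3F r → contradiction (Eq.symmetric _ (arc⊆component r ◅◅ across (e , 3F))) ¬e₀₁
          }

        e₀₁ : EqClosure (FaceStep B) (e , 0F) (e , 1F)
        e₀₁ = subst (λ s → EqClosure (FaceStep B) (e , 0F) (e , (if s then 1F else 3F)))
          after (step (there (here refl)) (e , 0F))

        -- At `e` the passage of `A` across an end is replaced by the boundary arc joining the same
        -- two corners, which also belongs to the boundary for `B`.
        boundaryA : ∀ x → EqClosure (FaceStep B) x (boundaryOn A x)
        boundaryA (e′ , j) with e′ ≟ e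
        boundaryA (e′ , j)  | no e≢ rewrite away e≢ = step (there (here refl)) (e′ , j)
        boundaryA (e′ , 0F) | yes refl rewrite before = arc⊆faceB e₀₃
        boundaryA (e′ , 1F) | yes refl rewrite before = arc⊆faceB e₁₂
        boundaryA (e′ , 2F) | yes refl rewrite before = Eq.symmetric _ (arc⊆faceB e₁₂)
        boundaryA (e′ , 3F) | yes refl rewrite before = Eq.symmetric _ (arc⊆faceB e₀₃)

      private
        Q : ∀ A → Quotient (ComponentStep A)
        Q A = orbits (arc ∷ end ∷ sideOn A ∷ [])

      components-antitone : c G B ≤ c G A
      components-antitone = ℕ.+-monoˡ-≤ isolated (size-≤ (Q A) (Q B) id components-A⊆B)

      components-drop : c G A ≤ suc (c G B)
      components-drop = ℕ.+-monoˡ-≤ isolated (size-adjoin (Q A) (Q B)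
        (components-B⊆ (Eq.map inj₁) (Eq.return (inj₂ (refl , refl)))))

      -- This says that the Euler genus 2c - |V| + |A| - f does not decrease, written without
      -- subtraction and with |B| = |A| + 1. If `e` lies within one component, c is unchanged and f
      -- rises by at most 1; otherwise c drops by at most 1 and f drops by at least 1.
      genus-step : f G B + 2 * c G A ≤ suc (f G A + 2 * c G B)
      genus-step with related? (Q A) (e , 0F) (e , 1F)
      ... | yes e₀₁ = ℕ.+-mono-≤ faces-≤ (ℕ.*-monoʳ-≤ 2
        (ℕ.+-monoˡ-≤ isolated (size-≤ (Q B) (Q A) id (components-B⊆ id e₀₁))))
      ... | no ¬e₀₁ = begin
        f G B + 2 * c G A                 ≤⟨ ℕ.+-monoʳ-≤ (f G B) (ℕ.*-monoʳ-≤ 2 components-drop) ⟩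
        f G B + 2 * suc (c G B)           ≡⟨ cong (f G B +_) (ℕ.*-suc 2 (c G B)) ⟩
        f G B + (2 + 2 * c G B)           ≡⟨ ℕ.+-suc (f G B) (suc (2 * c G B)) ⟩
        suc (f G B) + suc (2 * c G B)     ≤⟨ ℕ.+-monoˡ-≤ _ (faces-< ¬e₀₁) ⟩
        f G A + suc (2 * c G B)           ≡⟨ ℕ.+-suc (f G A) _ ⟩
        suc (f G A + 2 * c G B)           ∎
        where open ℕ.≤-Reasoning

    -- Monotonicity of the Euler genus and the exponents of the polynomials

    genus-monotone : ∀ {A B} → Star _⋖_ A B →
                     f G B + (2 * c G A + ∣ A ∣) ≤ f G A + (2 * c G B + ∣ B ∣)
    genus-monotone ε = ℕ.≤-refl
    -- The inequalities for the first edge and for the rest of the chain are added, and the terms of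
    -- `A′` common to both sides are cancelled.
    genus-monotone {A} {B} (_◅_ {j = A′} p ps) = ℕ.+-cancelˡ-≤ (f G A′ + (2 * c G A′ + ∣ A′ ∣)) _ _ (begin
      f G A′ + (2 * c G A′ + ∣ A′ ∣) + (f G B + (2 * c G A + ∣ A ∣))
        ≡⟨ solve 6 (λ x y z u v w → x :+ (y :+ z) :+ (u :+ (v :+ w)) :=
                     (u :+ (y :+ z)) :+ ((x :+ v) :+ w)) refl
             (f G A′) (2 * c G A′) (∣ A′ ∣) (f G B) (2 * c G A) (∣ A ∣) ⟩
      (f G B + (2 * c G A′ + ∣ A′ ∣)) + ((f G A′ + 2 * c G A) + ∣ A ∣)
        ≤⟨ ℕ.+-mono-≤ (genus-monotone ps)
             (ℕ.+-monoˡ-≤ ∣ A ∣ (EdgeAdded.genus-step (proj₂ (added p)))) ⟩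
      (f G A′ + (2 * c G B + ∣ B ∣)) + (suc (f G A + 2 * c G A′) + ∣ A ∣)
        ≡⟨ solve 6 (λ x y z u v w → (x :+ (y :+ z)) :+ (con 1 :+ (u :+ v) :+ w) :=
                     x :+ (v :+ (con 1 :+ w)) :+ (u :+ (y :+ z))) refl
             (f G A′) (2 * c G B) (∣ B ∣) (f G A) (2 * c G A′) (∣ A ∣) ⟩
      f G A′ + (2 * c G A′ + suc ∣ A ∣) + (f G A + (2 * c G B + ∣ B ∣))
        ≡⟨ cong (λ s → f G A′ + (2 * c G A′ + s) + (f G A + (2 * c G B + ∣ B ∣))) (∣⋖∣ p) ⟨
      f G A′ + (2 * c G A′ + ∣ A′ ∣) + (f G A + (2 * c G B + ∣ B ∣)) ∎)
      where
      open ℕ.≤-Reasoning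
      open +-*-Solver

    components-monotone : ∀ {A B} → Star _⋖_ A B → c G B ≤ c G A
    components-monotone ε        = ℕ.≤-refl
    components-monotone (p ◅ ps) =
      ℕ.≤-trans (components-monotone ps) (EdgeAdded.components-antitone (proj₂ (added p)))

    -- Each added edge lowers the number of components by at most 1. Starting from `⊥`, this bounds
    -- the rank by the number of edges, so that the nullity is not truncated.
    components-drop* : ∀ {A B} → Star _⋖_ A B → c G A + ∣ A ∣ ≤ c G B + ∣ B ∣
    components-drop* ε                  = ℕ.≤-refl
    components-drop* {A} (_◅_ {j = A′} p ps) = ℕ.≤-trans (begin
      c G A + ∣ A ∣       ≤⟨ ℕ.+-monoˡ-≤ ∣ A ∣ (EdgeAdded.components-drop (proj₂ (added p))) ⟩
      suc (c G A′) + ∣ A ∣ ≡⟨ ℕ.+-suc (c G A′) ∣ A ∣ ⟨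
      c G A′ + suc ∣ A ∣   ≡⟨ cong (c G A′ +_) (∣⋖∣ p) ⟨
      c G A′ + ∣ A′ ∣      ∎)
      (components-drop* ps)
      where open ℕ.≤-Reasoning

    c-⊥ : c G ⊥ ≡ #V G
    c-⊥ = cong (_+ isolated) (ℕ.≤-antisym
      (size-≤ Qᵛ Qᶜ id (orbit-map id (step (here refl) ∷ step (there (here refl)) ∷ [])))
      (size-≤ Qᶜ Qᵛ id (orbit-map id (step (here refl) ∷ step (there (here refl)) ∷ side ∷ []))))
      where
      Qᵛ = orbits (arc ∷ end ∷ [])
      Qᶜ = orbits (arc ∷ end ∷ sideOn ⊥ ∷ [])

      side : ∀ x → EqClosure VertexStep x (sideOn ⊥ x)
      side (e , j) rewrite lookup-replicate e outside = ε

    -- Without edge discs the boundary passes across every end, exactly as the vertex circles do.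
    f-⊥ : f G ⊥ ≡ #V G
    f-⊥ = cong (_+ isolated) (ℕ.≤-antisym
      (size-≤ Qᵛ Qᶠ id (orbit-map id (step (here refl) ∷ across ∷ [])))
      (size-≤ Qᶠ Qᵛ id (orbit-map id (step (here refl) ∷ boundary ∷ []))))
      where
      Qᵛ = orbits (arc ∷ end ∷ [])
      Qᶠ = orbits (arc ∷ boundaryOn ⊥ ∷ [])

      boundary : ∀ x → EqClosure VertexStep x (boundaryOn ⊥ x)
      boundary (e , j) rewrite lookup-replicate e outside = step (there (here refl)) (e , j)

      across : ∀ x → EqClosure (FaceStep ⊥) x (end x)
      across (e , j) with lookup {n = m} ⊥ e | lookup-replicate e outside
                        | step {gs = arc ∷ boundaryOn ⊥ ∷ []} (there (here refl)) (e , j)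
      ... | outside | refl | p = p

    c≤#V : ∀ A → c G A ≤ #V G
    c≤#V A = subst (c G A ≤_) c-⊥ (components-monotone (⊥⋖* A))

    r≤∣A∣ : ∀ A → r G A ≤ ∣ A ∣
    r≤∣A∣ A = ℕ.m≤n+o⇒m∸n≤o (#V G) (c G A)
      (subst (_≤ c G A + ∣ A ∣) (trans (cong₂ _+_ c-⊥ (∣⊥∣≡0 m)) (ℕ.+-identityʳ _))
        (components-drop* (⊥⋖* A)))

    r+c : ∀ A → r G A + c G A ≡ #V G
    r+c A = ℕ.m∸n+n≡m (c≤#V A)

    r+n : ∀ A → r G A + n G A ≡ ∣ A ∣
    r+n A = ℕ.m+[n∸m]≡n (r≤∣A∣ A)

    r-monotone : ∀ A → r G A ≤ r G ⊤
    r-monotone A = ℕ.∸-monoʳ-≤ (#V G) (components-monotone (⋖*⊤ A))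

    -- Rank plus number of components is `#V G` for both `A` and `⊤`. In the prefactor of the
    -- polynomials this completes the exponent `c G ⊤` to `c G A`.
    c⊤+[r⊤∸rA] : ∀ A → c G ⊤ + (r G ⊤ ∸ r G A) ≡ c G A
    c⊤+[r⊤∸rA] A = ℕ.+-cancelˡ-≡ (r G A) _ _ (begin
      r G A + (c G ⊤ + (r G ⊤ ∸ r G A))
        ≡⟨ solve 3 (λ x y z → x :+ (y :+ z) := (x :+ z) :+ y) refl (r G A) (c G ⊤) _ ⟩
      (r G A + (r G ⊤ ∸ r G A)) + c G ⊤
        ≡⟨ cong (_+ c G ⊤) (ℕ.m+[n∸m]≡n (r-monotone A)) ⟩
      r G ⊤ + c G ⊤
        ≡⟨ trans (r+c ⊤) (sym (r+c A)) ⟩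
      r G A + c G A ∎)
      where
      open ≡-Reasoning
      open +-*-Solver

    private
      -- This links the form of the Euler genus in `genus-monotone` to the exponent of z, which is c
      -- + n - f.
      2c+∣A∣ : ∀ A → 2 * c G A + ∣ A ∣ ≡ (c G A + n G A) + #V G
      2c+∣A∣ A = begin
        2 * c G A + ∣ A ∣
          ≡⟨ cong (2 * c G A +_) (r+n A) ⟨
        2 * c G A + (r G A + n G A)
          ≡⟨ solve 3 (λ x y z → con 2 :* x :+ (y :+ z) := (x :+ z) :+ (y :+ x)) refl
               (c G A) (r G A) (n G A) ⟩
        (c G A + n G A) + (r G A + c G A)
          ≡⟨ cong (c G A + n G A +_) (r+c A) ⟩
        (c G A + n G A) + #V G ∎
        where
        open ≡-Reasoning
        open +-*-Solver

    -- The Euler genus is 0 at `⊥` and grows along the chain from `⊥` to `A`, so it is nowhere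
    -- negative.
    f≤c+n : ∀ A → f G A ≤ c G A + n G A
    f≤c+n A = ℕ.+-cancelʳ-≤ (#V G + #V G) _ _ (begin
      f G A + (#V G + #V G)
        ≡⟨ cong (λ z → f G A + (#V G + z)) (ℕ.+-identityʳ (#V G)) ⟨
      f G A + 2 * #V G
        ≡⟨ cong (f G A +_) (ℕ.+-identityʳ (2 * #V G)) ⟨
      f G A + (2 * #V G + 0)
        ≡⟨ cong (f G A +_) (cong₂ (λ x y → 2 * x + y) (sym c-⊥) (sym (∣⊥∣≡0 m))) ⟩
      f G A + (2 * c G ⊥ + ∣ ⊥ {m} ∣)
        ≤⟨ genus-monotone (⊥⋖* A) ⟩
      f G ⊥ + (2 * c G A + ∣ A ∣)
        ≡⟨ cong₂ _+_ f-⊥ (2c+∣A∣ A) ⟩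
      #V G + ((c G A + n G A) + #V G)
        ≡⟨ solve 2 (λ v x → v :+ (x :+ v) := x :+ (v :+ v)) refl (#V G) (c G A + n G A) ⟩
      (c G A + n G A) + (#V G + #V G) ∎)
      where
      open ℕ.≤-Reasoning
      open +-*-Solver

    -- The Euler genus is 0 at `⊤`, and the chain from `A` to `⊤` bounds that of `A` by it.
    plane-genus : Plane G → ∀ A → (c G A + n G A) ∸ f G A ≡ 0
    plane-genus plane A = ℕ.m≤n⇒m∸n≡0 {c G A + n G A} {f G A} (ℕ.+-cancelʳ-≤ (#V G + f G ⊤) _ _ (begin
      (c G A + n G A) + (#V G + f G ⊤)
        ≡⟨ solve 3 (λ x v y → x :+ (v :+ y) := y :+ (x :+ v)) refl (c G A + n G A) (#V G) (f G ⊤) ⟩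
      f G ⊤ + ((c G A + n G A) + #V G)
        ≡⟨ cong (f G ⊤ +_) (2c+∣A∣ A) ⟨
      f G ⊤ + (2 * c G A + ∣ A ∣)
        ≤⟨ genus-monotone (⋖*⊤ A) ⟩
      f G A + (2 * c G ⊤ + ∣ ⊤ {m} ∣)
        ≡⟨ cong (f G A +_) (cong₂ (λ x y → 2 * x + y) connected (∣⊤∣≡n m)) ⟩
      f G A + (2 + m)
        ≡⟨ cong (f G A +_) (trans (ℕ.+-comm 2 m) (sym euler)) ⟩
      f G A + (#V G + f G ⊤) ∎))
      where
      open Plane plane
      open ℕ.≤-Reasoning
      open +-*-Solver

  -- Colourings constant along the boundary of a state

  words-unique : ∀ {A : Set} {as : List A} → Unique as → ∀ n → Unique (words as n)
  words-unique u zero    = [] ∷ []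
  words-unique u (suc n) = Unique.cartesianProductWith⁺ _∷_ ∷-injective u (words-unique u n)

  ∈-words : ∀ {k n} (w : Vec (Fin k) n) → w ∈ words (allFin k) n
  ∈-words []      = here refl
  ∈-words (i ∷ w) = ∈-cartesianProductWith⁺ _∷_ (∈-allFin i) (∈-words w)

  length-words : ∀ {A : Set} (as : List A) n → length (words as n) ≡ length as ^ n
  length-words as zero    = refl
  length-words as (suc n) = trans (go as (words as n)) (cong (length as *_) (length-words as n))
    where
    go : ∀ {B C D : Set} {f : B → C → D} bs cs →
         length (List.cartesianProductWith f bs cs) ≡ length bs * length cs
    go []       cs = refl
    go {f = f} (b ∷ bs) cs = trans (length-++ (map (f b) cs))
      (cong₂ _+_ (length-map (f b) cs) (go bs cs))

  module _ {k N M} (π : Fin N → Fin M) (π-surjective : ∀ j → ∃ λ i → π i ≡ j)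
           {P : Vec (Fin k) N → Set} (P? : Unary.Decidable P)
           (P⁺ : ∀ ψ → P (tabulate (lookup ψ ∘ π)))
           (P⁻ : ∀ φ → P φ → ∀ {i j} → π i ≡ π j → lookup φ i ≡ lookup φ j) where

    -- `P` singles out the colourings constant on the fibres of `π`, and these are the pullbacks of
    -- colourings of its target. Both lists are free of repetitions and have the same members, hence
    -- the same length.
    count-factoring : length (filter P? (words (allFin k) N)) ≡ k ^ M
    count-factoring = begin
      length (filter P? (words (allFin k) N))
        ≡⟨ ↭-length (∼bag⇒↭ (unique∧set⇒bag
             (Unique.filter⁺ P? (words-unique (Unique.allFin⁺ k) N))
             (Unique.map⁺ pull-injective (words-unique (Unique.allFin⁺ k) M))
             (mk⇔ to from))) ⟩
      length (map pull (words (allFin k) M))  ≡⟨ length-map pull (words (allFin k) M) ⟩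
      length (words (allFin k) M)             ≡⟨ length-words (allFin k) M ⟩
      length (allFin k) ^ M                   ≡⟨ cong (_^ M) (length-tabulate {n = k} id) ⟩
      k ^ M                                   ∎
      where
      open ≡-Reasoning

      pull : Vec (Fin k) M → Vec (Fin k) N
      pull ψ = tabulate (lookup ψ ∘ π)

      push : Vec (Fin k) N → Vec (Fin k) M
      push φ = tabulate (lookup φ ∘ proj₁ ∘ π-surjective)

      push-pull : ∀ ψ → push (pull ψ) ≡ ψ
      push-pull ψ = trans (tabulate-cong λ j → trans (lookup∘tabulate (lookup ψ ∘ π) _)
        (cong (lookup ψ) (proj₂ (π-surjective j)))) (tabulate∘lookup ψ)

      pull-push : ∀ φ → P φ → pull (push φ) ≡ φ
      pull-push φ Pφ = trans (tabulate-cong λ i →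
        trans (lookup∘tabulate (lookup φ ∘ proj₁ ∘ π-surjective) (π i))
          (P⁻ φ Pφ (proj₂ (π-surjective (π i))))) (tabulate∘lookup φ)

      pull-injective : ∀ {ψ ψ′} → pull ψ ≡ pull ψ′ → ψ ≡ ψ′
      pull-injective {ψ} {ψ′} e = trans (sym (push-pull ψ)) (trans (cong push e) (push-pull ψ′))

      to : ∀ {φ} → φ ∈ filter P? (words (allFin k) N) → φ ∈ map pull (words (allFin k) M)
      to {φ} φ∈ = subst (_∈ map pull (words (allFin k) M))
        (pull-push φ (proj₂ (∈-filter⁻ P? {xs = words (allFin k) N} φ∈)))
        (∈-map⁺ pull (∈-words (push φ)))

      from : ∀ {φ} → φ ∈ map pull (words (allFin k) M) → φ ∈ filter P? (words (allFin k) N)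
      from φ∈ with ψ , _ , refl ← ∈-map⁻ pull φ∈ = ∈-filter⁺ P? (∈-words (pull ψ)) (P⁺ ψ)

  -- Smoothings at a vertex and the parity of colours

  Agree : ∀ {k} → (Fin 4 → Fin 4) → (Fin 4 → Fin k) → Set
  Agree t χ = ∀ j → χ j ≡ χ (t j)

  agree? : ∀ {k} t (χ : Fin 4 → Fin k) → Dec (Agree t χ)
  agree? t χ = all? λ j → χ j ≟ χ (t j)

  choose : ∀ {n} → (p q : Fin 4 → Fin 4) → Subset n → Fin n → Fin 4 → Fin 4
  choose p q A e j = if lookup A e then p j else q j

  -- The pattern of `boundaryOn` with arbitrary pairings of the corners, so that the Penrose states,
  -- made of diagonals and sides, are covered too.
  smooth : ∀ {n} → (p q : Fin 4 → Fin 4) → Subset n → Corner n → Corner n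
  smooth p q A (e , j) = e , choose p q A e j

  length-filter : ∀ {A : Set} {P : A → Set} (P? : Unary.Decidable P) {n} (g : Fin n → A) →
                  length (filter P? (List.tabulate g)) ≡ sum (λ i → 𝟙 (P? (g i)))
  length-filter P? {zero}  g = refl
  length-filter P? {suc n} g with P? (g zero)
  ... | yes _ = cong suc (length-filter P? (g ∘ suc))
  ... | no _  = length-filter P? (g ∘ suc)

  count : ∀ {k} → (Fin 4 → Fin k) → Fin k → ℕ
  count χ i = length (filter (λ j → χ j ≟ i) (allFin 4))

  opposite : Fin 4 → Fin 4
  opposite 0F = 2F
  opposite 1F = 3F
  opposite 2F = 0F
  opposite 3F = 1F

  module _ {k} (χ : Fin 4 → Fin k) where

    count-𝟙 : ∀ i → count χ i ≡
              𝟙 (χ 0F ≟ i) + (𝟙 (χ 1F ≟ i) + (𝟙 (χ 2F ≟ i) + (𝟙 (χ 3F ≟ i) + 0)))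
    count-𝟙 i = length-filter (λ j → χ j ≟ i) id

    -- The half-edges fall into two pairs of equal colour, so a colour is counted twice for each
    -- pair that carries it. The other two pairings are treated alike.
    even-along : Agree alongSide χ → ∀ i → 2 ∣ count χ i
    even-along s i = divides (𝟙 (χ 1F ≟ i) + 𝟙 (χ 3F ≟ i)) (begin
      count χ i
        ≡⟨ count-𝟙 i ⟩
      𝟙 (χ 0F ≟ i) + (𝟙 (χ 1F ≟ i) + (𝟙 (χ 2F ≟ i) + (𝟙 (χ 3F ≟ i) + 0)))
        ≡⟨ cong₂ (λ x y → 𝟙 (x ≟ i) + (𝟙 (χ 1F ≟ i) + (𝟙 (y ≟ i) + (𝟙 (χ 3F ≟ i) + 0))))
             (s 0F) (s 2F) ⟩
      𝟙 (χ 1F ≟ i) + (𝟙 (χ 1F ≟ i) + (𝟙 (χ 3F ≟ i) + (𝟙 (χ 3F ≟ i) + 0)))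
        ≡⟨ solve 2 (λ x y → x :+ (x :+ (y :+ (y :+ con 0))) := (x :+ y) :* con 2) refl
             (𝟙 (χ 1F ≟ i)) (𝟙 (χ 3F ≟ i)) ⟩
      (𝟙 (χ 1F ≟ i) + 𝟙 (χ 3F ≟ i)) * 2 ∎)
      where
      open ≡-Reasoning
      open +-*-Solver

    even-across : Agree acrossEnd χ → ∀ i → 2 ∣ count χ i
    even-across s i = divides (𝟙 (χ 3F ≟ i) + 𝟙 (χ 2F ≟ i)) (begin
      count χ i
        ≡⟨ count-𝟙 i ⟩
      𝟙 (χ 0F ≟ i) + (𝟙 (χ 1F ≟ i) + (𝟙 (χ 2F ≟ i) + (𝟙 (χ 3F ≟ i) + 0)))
        ≡⟨ cong₂ (λ x y → 𝟙 (x ≟ i) + (𝟙 (y ≟ i) + (𝟙 (χ 2F ≟ i) + (𝟙 (χ 3F ≟ i) + 0))))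
             (s 0F) (s 1F) ⟩
      𝟙 (χ 3F ≟ i) + (𝟙 (χ 2F ≟ i) + (𝟙 (χ 2F ≟ i) + (𝟙 (χ 3F ≟ i) + 0)))
        ≡⟨ solve 2 (λ x y → x :+ (y :+ (y :+ (x :+ con 0))) := (x :+ y) :* con 2) refl
             (𝟙 (χ 3F ≟ i)) (𝟙 (χ 2F ≟ i)) ⟩
      (𝟙 (χ 3F ≟ i) + 𝟙 (χ 2F ≟ i)) * 2 ∎)
      where
      open ≡-Reasoning
      open +-*-Solver

    even-opposite : Agree opposite χ → ∀ i → 2 ∣ count χ i
    even-opposite s i = divides (𝟙 (χ 2F ≟ i) + 𝟙 (χ 3F ≟ i)) (begin
      count χ i
        ≡⟨ count-𝟙 i ⟩
      𝟙 (χ 0F ≟ i) + (𝟙 (χ 1F ≟ i) + (𝟙 (χ 2F ≟ i) + (𝟙 (χ 3F ≟ i) + 0)))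
        ≡⟨ cong₂ (λ x y → 𝟙 (x ≟ i) + (𝟙 (y ≟ i) + (𝟙 (χ 2F ≟ i) + (𝟙 (χ 3F ≟ i) + 0))))
             (s 0F) (s 1F) ⟩
      𝟙 (χ 2F ≟ i) + (𝟙 (χ 3F ≟ i) + (𝟙 (χ 2F ≟ i) + (𝟙 (χ 3F ≟ i) + 0)))
        ≡⟨ solve 2 (λ x y → x :+ (y :+ (x :+ (y :+ con 0))) := (x :+ y) :* con 2) refl
             (𝟙 (χ 2F ≟ i)) (𝟙 (χ 3F ≟ i)) ⟩
      (𝟙 (χ 2F ≟ i) + 𝟙 (χ 3F ≟ i)) * 2 ∎)
      where
      open ≡-Reasoning
      open +-*-Solver

  module _ (G : RibbonGraph) where
    open RibbonGraph G renaming (edges to m)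

    -- f G A is states alongSide acrossEnd A by definition.
    states : (p q : Fin 4 → Fin 4) → Subset m → ℕ
    states p q A = #orbits (arc ∷ smooth p q A ∷ []) + isolated

    -- Conjugation by the involution `swapEnd A` undoes the twist of the arcs. It carries the
    -- boundary of the twisted graph to the smoothing in which the sides 0-1 and 2-3 of a twisted
    -- edge have become the diagonals 0-2 and 1-3.
    f-partialPetrial : ∀ A → f (partialPetrial G A) ⊤ ≡ states opposite alongSide A
    f-partialPetrial A = cong (_+ isolated) (ℕ.≤-antisym
      (size-≤ Qˢ Qᵖ (swapEnd A) λ r → unswap (orbit-map (swapEnd A) (arc′ ∷ smooth′ ∷ []) r))
      (size-≤ Qᵖ Qˢ (swapEnd A) λ r → unswap (orbit-map (swapEnd A) (arcₛ ∷ boundaryₛ ∷ []) r)))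
      where
      arcᵖ = RibbonGraph.arc (partialPetrial G A)
      Qᵖ = orbits (arcᵖ ∷ boundaryOn ⊤ ∷ [])
      Qˢ = orbits (arc ∷ smooth opposite alongSide A ∷ [])

      unswap : ∀ {S x y} → EqClosure S (swapEnd A (swapEnd A x)) (swapEnd A (swapEnd A y)) →
               EqClosure S x y
      unswap {S} {x} {y} r rewrite swapEnd-involutive A x | swapEnd-involutive A y = r

      conjugate : ∀ x → swapEnd A (smooth opposite alongSide A x) ≡ boundaryOn ⊤ (swapEnd A x)
      conjugate (e , j) with lookup {n = m} ⊤ e | lookup-replicate e inside
      conjugate (e , j)  | inside | refl with lookup A e
      conjugate (e , j)  | inside | refl | outside = refl
      conjugate (e , 0F) | inside | refl | inside = refl
      conjugate (e , 1F) | inside | refl | inside = refl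
      conjugate (e , 2F) | inside | refl | inside = refl
      conjugate (e , 3F) | inside | refl | inside = refl

      arc′ : ∀ x → EqClosure (Step (arcᵖ ∷ boundaryOn ⊤ ∷ [])) (swapEnd A x) (swapEnd A (arc x))
      arc′ x = subst (λ y → EqClosure _ (swapEnd A x) (swapEnd A (arc y)))
        (swapEnd-involutive A x) (step (here refl) (swapEnd A x))

      smooth′ : ∀ x → EqClosure (Step (arcᵖ ∷ boundaryOn ⊤ ∷ [])) (swapEnd A x)
                  (swapEnd A (smooth opposite alongSide A x))
      smooth′ x = subst (EqClosure _ (swapEnd A x)) (sym (conjugate x))
        (step (there (here refl)) (swapEnd A x))

      arcₛ : ∀ x → EqClosure (Step (arc ∷ smooth opposite alongSide A ∷ []))
               (swapEnd A x) (swapEnd A (arcᵖ x))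
      arcₛ x = subst (EqClosure _ (swapEnd A x)) (sym (swapEnd-involutive A _))
        (step (here refl) (swapEnd A x))

      boundaryₛ : ∀ x → EqClosure (Step (arc ∷ smooth opposite alongSide A ∷ []))
                    (swapEnd A x) (swapEnd A (boundaryOn ⊤ x))
      boundaryₛ x = subst (EqClosure _ (swapEnd A x))
        (trans (sym (swapEnd-involutive A _)) (cong (swapEnd A)
          (trans (conjugate (swapEnd A x)) (cong (boundaryOn ⊤) (swapEnd-involutive A x)))))
        (step (there (here refl)) (swapEnd A x))

    module _ (k : ℕ) (p q : Fin 4 → Fin 4) (A : Subset m) where
      open Valuations (medial G) k
      open CheckerboardGraph (medial G) using (#edges; edgeOf)

      Follows : Colouring → Set
      Follows φ = ∀ e → Agree (choose p q A e) (colour φ e)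

      follows? : Unary.Decidable Follows
      follows? φ = all? λ e → agree? (choose p q A e) (colour φ e)

      -- Such a colouring is a free choice of one colour for each closed curve of the state. The map
      -- `π` sends a medial edge to the curve through it and a free loop to itself.
      count-follows : length (filter follows? colourings) ≡ k ^ states p q A
      count-follows = count-factoring π π-surjective follows? pulled pushed
        where
        Q₁ = orbits (arc ∷ [])
        Q₂ = orbits (arc ∷ smooth p q A ∷ [])
        module Q₁ = Quotient Q₁
        module Q₂ = Quotient Q₂

        π₁ : Fin Q₁.size → Fin Q₂.size
        π₁ = Q₂.class ∘ representative Q₁

        π₁-class : ∀ x → π₁ (Q₁.class x) ≡ Q₂.class x
        π₁-class x = Q₂.sound (orbit-map id (step (here refl) ∷ [])
          (Q₁.complete (class-representative Q₁ (Q₁.class x))))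

        π : Fin #edges → Fin (states p q A)
        π = Fin.join Q₂.size isolated ∘ Sum.map π₁ id ∘ splitAt Q₁.size

        π-edgeOf : ∀ x → π (edgeOf x) ≡ Q₂.class x ↑ˡ isolated
        π-edgeOf x rewrite splitAt-↑ˡ Q₁.size (Q₁.class x) isolated =
          cong (_↑ˡ isolated) (π₁-class x)

        π-surjective : ∀ j → ∃ λ i → π i ≡ j
        π-surjective j with splitAt Q₂.size j in eq
        ... | inj₁ a = edgeOf (representative Q₂ a) ,
          trans (π-edgeOf _)
            (trans (cong (_↑ˡ isolated) (class-representative Q₂ a)) (splitAt⁻¹-↑ˡ eq))
        ... | inj₂ l = Q₁.size ↑ʳ l ,
          trans (cong (Fin.join Q₂.size isolated ∘ Sum.map π₁ id) (splitAt-↑ʳ Q₁.size isolated l))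
            (splitAt⁻¹-↑ʳ eq)

        pulled : ∀ ψ → Follows (tabulate (lookup ψ ∘ π))
        pulled ψ e j = trans (lookup-edgeOf (e , j))
          (trans (cong (λ i → lookup ψ (i ↑ˡ isolated)) (Q₂.sound (step (there (here refl)) (e , j))))
            (sym (lookup-edgeOf (e , choose p q A e j))))
          where
          lookup-edgeOf : ∀ x → lookup (tabulate (lookup ψ ∘ π)) (edgeOf x) ≡
                                lookup ψ (Q₂.class x ↑ˡ isolated)
          lookup-edgeOf x = trans (lookup∘tabulate (lookup ψ ∘ π) (edgeOf x))
            (cong (lookup ψ) (π-edgeOf x))

        splitAt-π : ∀ i i′ → π i ≡ π i′ →
                    Sum.map π₁ id (splitAt Q₁.size i) ≡ Sum.map π₁ id (splitAt Q₁.size i′)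
        splitAt-π i i′ e = trans (sym (split-join (Sum.map π₁ id (splitAt Q₁.size i))))
          (trans (cong (splitAt Q₂.size) e) (split-join (Sum.map π₁ id (splitAt Q₁.size i′))))
          where
          split-join = splitAt-join Q₂.size isolated

        pushed : ∀ φ → Follows φ → ∀ {i i′} → π i ≡ π i′ → lookup φ i ≡ lookup φ i′
        -- A curve through vertices is never a free loop, so only the two unmixed cases remain.
        pushed φ follows {i} {i′} e
          with splitAt Q₁.size i in eq | splitAt Q₁.size i′ in eq′ | splitAt-π i i′ e
        ... | inj₁ a | inj₁ a′ | e₁ = begin
          lookup φ i                               ≡⟨ cong (lookup φ) (edgeOf-representative eq) ⟨
          lookup φ (edgeOf (representative Q₁ a))  ≡⟨ constant (Q₂.complete (inj₁-injective e₁)) ⟩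
          lookup φ (edgeOf (representative Q₁ a′)) ≡⟨ cong (lookup φ) (edgeOf-representative eq′) ⟩
          lookup φ i′                              ∎
          where
          open ≡-Reasoning
          edgeOf-representative : ∀ {i a} → splitAt Q₁.size i ≡ inj₁ a →
                                  edgeOf (representative Q₁ a) ≡ i
          edgeOf-representative {a = a} eq =
            trans (cong (_↑ˡ isolated) (class-representative Q₁ a)) (splitAt⁻¹-↑ˡ eq)

          along : ∀ {x y} → Step (arc ∷ smooth p q A ∷ []) x y →
                  lookup φ (edgeOf x) ≡ lookup φ (edgeOf y)
          along {x} (here refl) =
            cong (λ i → lookup φ (i ↑ˡ isolated)) (Q₁.sound (step (here refl) x))
          along {e , j} (there (here refl)) = follows e j

          constant : ∀ {x y} → EqClosure (Step (arc ∷ smooth p q A ∷ [])) x y →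
                     lookup φ (edgeOf x) ≡ lookup φ (edgeOf y)
          constant = Eq.gfold isEquivalence (lookup φ ∘ edgeOf) along
        ... | inj₂ l | inj₂ l′ | e₂ = cong (lookup φ) (trans (sym (splitAt⁻¹-↑ʳ eq))
          (trans (cong (Q₁.size ↑ʳ_) (inj₂-injective e₂)) (splitAt⁻¹-↑ʳ eq′)))

  -- Vertex types in terms of agreeing pairs

  module AtVertex (G : RibbonGraph) (k : ℕ) (φ : Valuations.Colouring (medial G) k)
                  (v : Fin (RibbonGraph.edges G)) where
    open Valuations (medial G) k

    χ : Fin 4 → Fin k
    χ = colour φ v

    along-agree : χ 0F ≡ χ 1F → χ 2F ≡ χ 3F → Agree alongSide χ
    along-agree p q 0F = p
    along-agree p q 1F = sym p
    along-agree p q 2F = q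
    along-agree p q 3F = sym q

    across-agree : χ 1F ≡ χ 2F → χ 3F ≡ χ 0F → Agree acrossEnd χ
    across-agree p q 0F = sym q
    across-agree p q 1F = p
    across-agree p q 2F = sym p
    across-agree p q 3F = q

    opposite-agree : χ 0F ≡ χ 2F → χ 1F ≡ χ 3F → Agree opposite χ
    opposite-agree p q 0F = p
    opposite-agree p q 1F = q
    opposite-agree p q 2F = sym p
    opposite-agree p q 3F = sym q

    total-along : Total φ v → Agree alongSide χ
    total-along (p , _ , r) = along-agree p r

    total-across : Total φ v → Agree acrossEnd χ
    total-across (p , q , r) = across-agree q (sym (trans p (trans q r)))

    total-opposite : Total φ v → Agree opposite χ
    total-opposite (p , q , r) = opposite-agree (trans p q) (trans q r)

    along-across-total : Agree alongSide χ → Agree acrossEnd χ → Total φ v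
    along-across-total s t = s 0F , t 1F , s 2F

    along-opposite-total : Agree alongSide χ → Agree opposite χ → Total φ v
    along-opposite-total s t = s 0F , trans (sym (s 0F)) (t 0F) , s 2F

  module _ (G : RibbonGraph) (k : ℕ) (φ : Valuations.Colouring (medial G) k) where
    open Valuations (medial G) k
    open AtVertex G k φ

    -- Every one of the three types pairs off equally coloured half-edges, which gives the evenness
    -- condition. Hence a colouring that is not permissible already fails at some vertex.
    local⇒rPermissible : (∀ v → White φ v ⊎ Black φ v ⊎ Total φ v) → RPermissible φ
    local⇒rPermissible h = (λ i v → even v i (h v)) , h
      where
      even : ∀ v i → White φ v ⊎ Black φ v ⊎ Total φ v → 2 ∣ #half-edges φ i v
      even v i (inj₁ (_ , p , q))        = even-along (colour φ v) (along-agree v p q) i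
      even v i (inj₂ (inj₁ (_ , p , q))) = even-across (colour φ v) (across-agree v p q) i
      even v i (inj₂ (inj₂ t))           = even-along (colour φ v) (total-along v t) i

    local⇒admissible : (∀ v → White φ v ⊎ Crossing φ v) → Admissible φ
    local⇒admissible h = (λ i v → even v i (h v)) , h
      where
      even : ∀ v i → White φ v ⊎ Crossing φ v → 2 ∣ #half-edges φ i v
      even v i (inj₁ (_ , p , q)) = even-along (colour φ v) (along-agree v p q) i
      even v i (inj₂ (_ , p , q)) = even-opposite (colour φ v) (opposite-agree v p q) i

open Combinatorics

-- State sums in a commutative ring

module Sums {a ℓ} (K : CommutativeRing a ℓ) where
  open CommutativeRing K hiding (zero)
  open Polynomials K
  open import Relation.Binary.Reasoning.Setoid setoid
  open import Algebra.Properties.Semiring.Exp semiring using (^-homo-*; ^-congˡ; ^-congʳ)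
  open import Algebra.Properties.CommutativeSemiring.Exp commutativeSemiring using (^-distrib-*)
  open import Algebra.Properties.Semiring.Mult semiring using (×1-homo-*) renaming (_×_ to _·_)
  open import Algebra.Properties.CommutativeMonoid.Sum *-commutativeMonoid
    using () renaming (sum to ∏; sum-cong-≋ to ∏-cong; ∑-distrib-+ to ∏-distrib-*)
  open import Algebra.Properties.CommutativeSemigroup +-commutativeSemigroup
    using () renaming (interchange to +-interchange)
  open import Algebra.Solver.CommutativeMonoid *-commutativeMonoid using (solve; _⊕_; _⊜_)

  module _ {I : Set} where

    ∑-cong : ∀ (is : List I) {t u : I → Carrier} → (∀ i → t i ≈ u i) → ∑ is t ≈ ∑ is u
    ∑-cong []       t≈u = refl
    ∑-cong (i ∷ is) t≈u = +-cong (t≈u i) (∑-cong is t≈u)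

    ∑-++ : ∀ (is js : List I) t → ∑ (is ++ js) t ≈ ∑ is t + ∑ js t
    ∑-++ []       js t = sym (+-identityˡ _)
    ∑-++ (i ∷ is) js t = trans (+-congˡ (∑-++ is js t)) (sym (+-assoc _ _ _))

    ∑-distribˡ : ∀ x (is : List I) t → x * ∑ is t ≈ ∑ is (λ i → x * t i)
    ∑-distribˡ x []       t = zeroʳ x
    ∑-distribˡ x (i ∷ is) t = trans (distribˡ x _ _) (+-congˡ (∑-distribˡ x is t))

    ∑-+ : ∀ (is : List I) t u → ∑ is (λ i → t i + u i) ≈ ∑ is t + ∑ is u
    ∑-+ []       t u = sym (+-identityˡ _)
    ∑-+ (i ∷ is) t u = trans (+-congˡ (∑-+ is t u)) (+-interchange _ _ _ _)

    ∑-0 : ∀ (is : List I) → ∑ is (λ _ → 0#) ≈ 0#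
    ∑-0 []       = refl
    ∑-0 (i ∷ is) = trans (+-identityˡ _) (∑-0 is)

    ∑-1 : ∀ (is : List I) → ∑ is (λ _ → 1#) ≈ length is · 1#
    ∑-1 []       = refl
    ∑-1 (i ∷ is) = +-congˡ (∑-1 is)

    ∑-filter : ∀ {P : I → Set} (P? : Unary.Decidable P) (is : List I) {t u : I → Carrier} →
               (∀ i → P i → t i ≈ u i) → (∀ i → ¬ P i → u i ≈ 0#) →
               ∑ (filter P? is) t ≈ ∑ is u
    ∑-filter P? []       y n = refl
    ∑-filter P? (i ∷ is) y n with P? i
    ... | yes p = +-cong (y i p) (∑-filter P? is y n)
    ... | no ¬p = trans (sym (+-identityˡ _)) (+-cong (sym (n i ¬p)) (∑-filter P? is y n))

  ∑-map : ∀ {I J : Set} (g : I → J) is t → ∑ (map g is) t ≈ ∑ is (t ∘ g)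
  ∑-map g []       t = refl
  ∑-map g (i ∷ is) t = +-congˡ (∑-map g is t)

  ∑-comm : ∀ {I J : Set} (is : List I) (js : List J) (t : I → J → Carrier) →
           ∑ is (λ i → ∑ js (t i)) ≈ ∑ js (λ j → ∑ is (λ i → t i j))
  ∑-comm []       js t = sym (∑-0 js)
  ∑-comm (i ∷ is) js t = trans (+-congˡ (∑-comm is js t)) (sym (∑-+ js (t i) _))

  1^ : ∀ n → 1# ^ n ≈ 1#
  1^ zero    = refl
  1^ (suc n) = trans (*-identityˡ _) (1^ n)

  ·1-homo-^ : ∀ k n → (k ℕ.^ n) · 1# ≈ (k · 1#) ^ n
  ·1-homo-^ k zero    = +-identityʳ 1#
  ·1-homo-^ k (suc n) = trans (×1-homo-* k (k ℕ.^ n)) (*-congˡ (·1-homo-^ k n))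

  ι : ∀ {P : Set} → Dec P → Carrier
  ι P? = if does P? then 1# else 0#

  ι-yes : ∀ {P : Set} (P? : Dec P) → P → ι P? ≈ 1#
  ι-yes (yes _) p = refl
  ι-yes (no ¬p) p = contradiction p ¬p

  ι-no : ∀ {P : Set} (P? : Dec P) → ¬ P → ι P? ≈ 0#
  ι-no (yes p) ¬p = contradiction p ¬p
  ι-no (no _)  ¬p = refl

  -- The default is `1#`, so that a product over all vertices is a power of `x`, as in `^-count`.
  when : ∀ {P : Set} → Dec P → Carrier → Carrier
  when P? x = if does P? then x else 1#

  when-yes : ∀ {P : Set} (P? : Dec P) → P → ∀ {x} → when P? x ≈ x
  when-yes (yes _) p = refl
  when-yes (no ¬p) p = contradiction p ¬p

  when-no : ∀ {P : Set} (P? : Dec P) → ¬ P → ∀ {x} → when P? x ≈ 1#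
  when-no (yes p) ¬p = contradiction p ¬p
  when-no (no _)  ¬p = refl

  ι-all : ∀ {n} {P : Fin n → Set} (P? : Unary.Decidable P) (∀P? : Dec (∀ i → P i)) →
          ι ∀P? ≈ ∏ (ι ∘ P?)
  ι-all {zero}  P? ∀P? = ι-yes ∀P? λ ()
  ι-all {suc n} {P} P? ∀P? = trans (go (P? zero) (all? (P? ∘ suc)))
    (*-congˡ (ι-all (P? ∘ suc) (all? (P? ∘ suc))))
    where
    go : (d : Dec (P zero)) (d′ : Dec (∀ i → P (suc i))) → ι ∀P? ≈ ι d * ι d′
    go (yes p) (yes ps) = trans (ι-yes ∀P? λ { zero → p ; (suc i) → ps i }) (sym (*-identityˡ 1#))
    go (yes p) (no ¬ps) = trans (ι-no ∀P? (λ h → ¬ps (h ∘ suc))) (sym (zeroʳ 1#))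
    go (no ¬p) d        = trans (ι-no ∀P? (λ h → ¬p (h zero))) (sym (zeroˡ _))

  ∏-zero : ∀ {n} (t : Fin n → Carrier) i → t i ≈ 0# → ∏ t ≈ 0#
  ∏-zero t zero    t≈0 = trans (*-congʳ t≈0) (zeroˡ _)
  ∏-zero t (suc i) t≈0 = trans (*-congˡ (∏-zero (t ∘ suc) i t≈0)) (zeroʳ _)

  ^-count : ∀ {A : Set} {P : A → Set} (P? : Unary.Decidable P) {n} (g : Fin n → A) x →
            x ^ length (filter P? (List.tabulate g)) ≈ ∏ (λ i → when (P? (g i)) x)
  ^-count P? {zero}  g x = refl
  ^-count P? {suc n} g x with does (P? (g zero))
  ... | true  = *-congˡ (^-count P? (g ∘ suc) x)
  ... | false = trans (^-count P? (g ∘ suc) x) (sym (*-identityˡ _))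

  -- The product on the right is expanded: `A` collects the factors from which `w * u e` is chosen,
  -- and the others contribute `v e`.
  ∑-subsets : ∀ w {n} (u v : Fin n → Carrier) →
              ∑ (subsets n) (λ A → w ^ ∣ A ∣ * ∏ (λ e → if lookup A e then u e else v e))
                ≈ ∏ (λ e → w * u e + v e)
  ∑-subsets w {zero}  u v = trans (+-identityʳ _) (*-identityʳ 1#)
  ∑-subsets w {suc n} u v = begin
    ∑ (map (outside ∷_) (subsets n) ++ map (inside ∷_) (subsets n) ++ []) t
      ≈⟨ trans (∑-++ (map (outside ∷_) (subsets n)) _ t)
           (+-cong (∑-map (outside ∷_) (subsets n) t)
             (trans (∑-++ (map (inside ∷_) (subsets n)) [] t)
               (trans (+-identityʳ _) (∑-map (inside ∷_) (subsets n) t)))) ⟩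
    ∑ (subsets n) (t ∘ (outside ∷_)) + ∑ (subsets n) (t ∘ (inside ∷_))
      ≈⟨ +-cong (factor (outside ∷_) (v zero) λ A → solve 3 (λ x y z →
                   (x ⊕ (y ⊕ z)) ⊜ (y ⊕ (x ⊕ z))) refl
                   (w ^ ∣ A ∣) (v zero) (∏ (λ e → if lookup A e then u (suc e) else v (suc e))))
           (factor (inside ∷_) (w * u zero) λ A → solve 4 (λ w x y z →
                   ((w ⊕ x) ⊕ (y ⊕ z)) ⊜ ((w ⊕ y) ⊕ (x ⊕ z))) refl
                   w (w ^ ∣ A ∣) (u zero) (∏ (λ e → if lookup A e then u (suc e) else v (suc e)))) ⟩
    v zero * ∏ʳ + (w * u zero) * ∏ʳ
      ≈⟨ trans (+-comm _ _) (sym (distribʳ ∏ʳ _ _)) ⟩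
    (w * u zero + v zero) * ∏ʳ ∎
    where
    t : Subset (suc n) → Carrier
    t A = w ^ ∣ A ∣ * ∏ (λ e → if lookup A e then u e else v e)

    t′ : Subset n → Carrier
    t′ A = w ^ ∣ A ∣ * ∏ (λ e → if lookup A e then u (suc e) else v (suc e))

    ∏ʳ : Carrier
    ∏ʳ = ∏ (λ e → w * u (suc e) + v (suc e))

    factor : (h : Subset n → Subset (suc n)) (x : Carrier) → (∀ A → t (h A) ≈ x * t′ A) →
             ∑ (subsets n) (t ∘ h) ≈ x * ∏ʳ
    factor h x eq = trans (∑-cong (subsets n) eq) (trans (sym (∑-distribˡ x (subsets n) t′))
      (*-congˡ (∑-subsets w (u ∘ suc) (v ∘ suc))))

  -- State sums over the colourings of the medial graph

  module _ (G : RibbonGraph) (k : ℕ) where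
    open RibbonGraph G renaming (edges to m)
    open Valuations (medial G) k hiding (tot; wh; cr)

    κ : Carrier
    κ = k · 1#

    local : (p q : Fin 4 → Fin 4) → Carrier → Colouring → Fin m → Carrier
    local p q w φ e = w * ι (agree? p (colour φ e)) + ι (agree? q (colour φ e))

    followed : (p q : Fin 4 → Fin 4) → Subset m → Colouring → Carrier
    followed p q A φ =
      ∏ λ e → if lookup A e then ι (agree? p (colour φ e)) else ι (agree? q (colour φ e))

    κ^states : ∀ p q A → κ ^ states G p q A ≈ ∑ colourings (followed p q A)
    κ^states p q A = begin
      κ ^ states G p q A
        ≈⟨ ·1-homo-^ k (states G p q A) ⟨
      (k ℕ.^ states G p q A) · 1#
        ≡⟨ ≡.cong (_· 1#) (count-follows G k p q A) ⟨
      length (filter follow? colourings) · 1#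
        ≈⟨ ∑-1 (filter follow? colourings) ⟨
      ∑ (filter follow? colourings) (λ _ → 1#)
        ≈⟨ ∑-filter follow? colourings
             (λ φ follows → sym (ι-yes (follow? φ) follows)) (λ φ → ι-no (follow? φ)) ⟩
      ∑ colourings (λ φ → ι (follow? φ))
        ≈⟨ ∑-cong colourings (λ φ → trans
             (ι-all (λ e → agree? (choose p q A e) (colour φ e)) (follow? φ))
             (∏-cong (factor φ))) ⟩
      ∑ colourings (followed p q A) ∎
      where
      follow? = follows? G k p q A

      factor : ∀ φ e → ι (agree? (choose p q A e) (colour φ e)) ≈
               (if lookup A e then ι (agree? p (colour φ e)) else ι (agree? q (colour φ e)))
      factor φ e with lookup A e
      ... | inside  = refl
      ... | outside = refl

    -- After the two sums are interchanged, the sum over `A` for a fixed colouring is a choice made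
    -- independently at each edge, so it factors over the vertices.
    state-sum : ∀ p q w → ∑ (subsets m) (λ A → w ^ ∣ A ∣ * κ ^ states G p q A) ≈
                          ∑ colourings (λ φ → ∏ (local p q w φ))
    state-sum p q w = begin
      ∑ (subsets m) (λ A → w ^ ∣ A ∣ * κ ^ states G p q A)
        ≈⟨ ∑-cong (subsets m) (λ A → trans (*-congˡ (κ^states p q A))
             (∑-distribˡ (w ^ ∣ A ∣) colourings (followed p q A))) ⟩
      ∑ (subsets m) (λ A → ∑ colourings (λ φ → w ^ ∣ A ∣ * followed p q A φ))
        ≈⟨ ∑-comm (subsets m) colourings (λ A φ → w ^ ∣ A ∣ * followed p q A φ) ⟩
      ∑ colourings (λ φ → ∑ (subsets m) (λ A → w ^ ∣ A ∣ * followed p q A φ))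
        ≈⟨ ∑-cong colourings (λ φ → ∑-subsets w
             (λ e → ι (agree? p (colour φ e))) (λ e → ι (agree? q (colour φ e)))) ⟩
      ∑ colourings (λ φ → ∏ (local p q w φ)) ∎

    module _ (φ : Colouring) (v : Fin m) where
      open AtVertex G k φ v

      weight : ∀ (p q : Fin 4 → Fin 4) {w x y} →
               ι (agree? p χ) ≈ x → ι (agree? q χ) ≈ y → local p q w φ v ≈ w * x + y
      weight p q x y = +-cong (*-congˡ x) y

      localᴿ : Carrier → Carrier
      localᴿ b = when (total? φ v) (b + 1#) * when (white? φ v) b

      -- The sides agree at white and total vertices, the ends at black and total ones. The weights
      -- are therefore b for white, 1 for black and b + 1 for total.
      weight-R : ∀ b → White φ v ⊎ Black φ v ⊎ Total φ v →
                 localᴿ b ≈ local alongSide acrossEnd b φ v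
      weight-R b (inj₁ w@(¬t , p , q)) = begin
        when (total? φ v) (b + 1#) * when (white? φ v) b
          ≈⟨ *-cong (when-no (total? φ v) ¬t) (when-yes (white? φ v) w) ⟩
        1# * b
          ≈⟨ trans (*-comm 1# b) (sym (+-identityʳ _)) ⟩
        b * 1# + 0#
          ≈⟨ weight alongSide acrossEnd (ι-yes (agree? alongSide χ) (along-agree p q))
               (ι-no (agree? acrossEnd χ) (¬t ∘ along-across-total (along-agree p q))) ⟨
        local alongSide acrossEnd b φ v ∎
      weight-R b (inj₂ (inj₁ (¬t , p , q))) = begin
        when (total? φ v) (b + 1#) * when (white? φ v) b
          ≈⟨ *-cong (when-no (total? φ v) ¬t) (when-no (white? φ v) λ (_ , p′ , q′) →
               ¬t (along-across-total (along-agree p′ q′) (across-agree p q))) ⟩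
        1# * 1#
          ≈⟨ trans (*-identityˡ 1#) (trans (sym (+-identityˡ 1#)) (+-congʳ (sym (zeroʳ b)))) ⟩
        b * 0# + 1#
          ≈⟨ weight alongSide acrossEnd
               (ι-no (agree? alongSide χ) (λ s → ¬t (along-across-total s (across-agree p q))))
               (ι-yes (agree? acrossEnd χ) (across-agree p q)) ⟨
        local alongSide acrossEnd b φ v ∎
      weight-R b (inj₂ (inj₂ t)) = begin
        when (total? φ v) (b + 1#) * when (white? φ v) b
          ≈⟨ *-cong (when-yes (total? φ v) t) (when-no (white? φ v) λ (¬t , _) → ¬t t) ⟩
        (b + 1#) * 1#
          ≈⟨ trans (*-identityʳ _) (+-congʳ (sym (*-identityʳ b))) ⟩
        b * 1# + 1#
          ≈⟨ weight alongSide acrossEnd (ι-yes (agree? alongSide χ) (total-along t))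
               (ι-yes (agree? acrossEnd χ) (total-across t)) ⟨
        local alongSide acrossEnd b φ v ∎

      weight-R-0 : ∀ b → ¬ (White φ v ⊎ Black φ v ⊎ Total φ v) →
                   local alongSide acrossEnd b φ v ≈ 0#
      weight-R-0 b none = trans
        (weight alongSide acrossEnd (ι-no (agree? alongSide χ) λ s → none (inj₁ (¬t , s 0F , s 2F)))
          (ι-no (agree? acrossEnd χ) λ s → none (inj₂ (inj₁ (¬t , s 1F , s 3F)))))
        (trans (+-identityʳ _) (zeroʳ b))
        where
        ¬t : ¬ Total φ v
        ¬t = none ∘ inj₂ ∘ inj₂

      -- Only the diagonals agree at a crossing vertex, giving -1, and only the sides at a white
      -- one, giving 1.
      weight-P : White φ v ⊎ Crossing φ v →
                 when (crossing? φ v) (- 1#) ≈ local opposite alongSide (- 1#) φ v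
      weight-P (inj₁ (¬t , p , q)) = begin
        when (crossing? φ v) (- 1#)
          ≈⟨ when-no (crossing? φ v) (λ (_ , p′ , q′) →
               ¬t (along-opposite-total (along-agree p q) (opposite-agree p′ q′))) ⟩
        1#
          ≈⟨ trans (sym (+-identityˡ 1#)) (+-congʳ (sym (zeroʳ _))) ⟩
        - 1# * 0# + 1#
          ≈⟨ weight opposite alongSide
               (ι-no (agree? opposite χ) (¬t ∘ along-opposite-total (along-agree p q)))
               (ι-yes (agree? alongSide χ) (along-agree p q)) ⟨
        local opposite alongSide (- 1#) φ v ∎
      weight-P (inj₂ c@(¬t , p , q)) = begin
        when (crossing? φ v) (- 1#)
          ≈⟨ when-yes (crossing? φ v) c ⟩
        - 1#
          ≈⟨ trans (sym (*-identityʳ _)) (sym (+-identityʳ _)) ⟩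
        - 1# * 1# + 0#
          ≈⟨ weight opposite alongSide (ι-yes (agree? opposite χ) (opposite-agree p q))
               (ι-no (agree? alongSide χ) λ s → ¬t (along-opposite-total s (opposite-agree p q))) ⟨
        local opposite alongSide (- 1#) φ v ∎

      -- At a total vertex diagonals and sides both agree, and the contributions -1 and 1 cancel. At
      -- any other excluded vertex neither pairing agrees.
      weight-P-0 : ¬ (White φ v ⊎ Crossing φ v) → local opposite alongSide (- 1#) φ v ≈ 0#
      weight-P-0 none = go (total? φ v)
        where
        go : Dec (Total φ v) → local opposite alongSide (- 1#) φ v ≈ 0#
        go (yes t) = trans
          (weight opposite alongSide (ι-yes (agree? opposite χ) (total-opposite t))
            (ι-yes (agree? alongSide χ) (total-along t)))
          (trans (+-congʳ (*-identityʳ _)) (-‿inverseˡ 1#))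
        go (no ¬t) = trans
          (weight opposite alongSide
            (ι-no (agree? opposite χ) λ s → none (inj₂ (¬t , s 0F , s 1F)))
            (ι-no (agree? alongSide χ) λ s → none (inj₁ (¬t , s 0F , s 2F))))
          (trans (+-identityʳ _) (zeroʳ _))

    ∑-rPermissible : ∀ b →
      ∑ (𝓡 (medial G) k) (λ φ → (b + 1#) ^ tot (medial G) k φ * b ^ wh (medial G) k φ)
        ≈ ∑ (subsets m) (λ A → b ^ ∣ A ∣ * κ ^ f G A)
    ∑-rPermissible b = trans (∑-filter rPermissible? colourings good bad)
      (sym (state-sum alongSide acrossEnd b))
      where
      good : ∀ φ → RPermissible φ →
             (b + 1#) ^ tot (medial G) k φ * b ^ wh (medial G) k φ ≈ ∏ (local alongSide acrossEnd b φ)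
      good φ (_ , h) = begin
        (b + 1#) ^ tot (medial G) k φ * b ^ wh (medial G) k φ
          ≈⟨ *-cong (^-count (total? φ) id (b + 1#)) (^-count (white? φ) id b) ⟩
        ∏ (λ v → when (total? φ v) (b + 1#)) * ∏ (λ v → when (white? φ v) b)
          ≈⟨ ∏-distrib-* (λ v → when (total? φ v) (b + 1#)) (λ v → when (white? φ v) b) ⟨
        ∏ (λ v → localᴿ φ v b)
          ≈⟨ ∏-cong (λ v → weight-R φ v b (h v)) ⟩
        ∏ (local alongSide acrossEnd b φ) ∎

      -- By decidability there is a vertex of none of the three types, and its factor annihilates
      -- the product.
      bad : ∀ φ → ¬ RPermissible φ → ∏ (local alongSide acrossEnd b φ) ≈ 0#
      bad φ ¬p =
        let v , ¬h = ¬∀⟶∃¬ m (λ v → White φ v ⊎ Black φ v ⊎ Total φ v)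
                       (λ v → white? φ v ⊎-dec black? φ v ⊎-dec total? φ v)
                       (¬p ∘ local⇒rPermissible G k φ)
        in ∏-zero (local alongSide acrossEnd b φ) v (weight-R-0 φ v b ¬h)

    P≈∑-admissible : P G κ ≈ ∑ (𝓐 (medial G) k) (λ φ → (- 1#) ^ cr (medial G) k φ)
    P≈∑-admissible = begin
      P G κ
        ≈⟨ ∑-cong (subsets m) (λ A → *-congˡ (^-congʳ κ (f-partialPetrial G A))) ⟩
      ∑ (subsets m) (λ A → (- 1#) ^ ∣ A ∣ * κ ^ states G opposite alongSide A)
        ≈⟨ state-sum opposite alongSide (- 1#) ⟩
      ∑ colourings (λ φ → ∏ (local opposite alongSide (- 1#) φ))
        ≈⟨ ∑-filter admissible? colourings good bad ⟨
      ∑ (𝓐 (medial G) k) (λ φ → (- 1#) ^ cr (medial G) k φ) ∎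
      where
      good : ∀ φ → Admissible φ → (- 1#) ^ cr (medial G) k φ ≈ ∏ (local opposite alongSide (- 1#) φ)
      good φ (_ , h) = trans (^-count (crossing? φ) id (- 1#)) (∏-cong (λ v → weight-P φ v (h v)))

      bad : ∀ φ → ¬ Admissible φ → ∏ (local opposite alongSide (- 1#) φ) ≈ 0#
      bad φ ¬p =
        let v , ¬h = ¬∀⟶∃¬ m (λ v → White φ v ⊎ Crossing φ v)
                       (λ v → white? φ v ⊎-dec crossing? φ v)
                       (¬p ∘ local⇒admissible G k φ)
        in ∏-zero (local opposite alongSide (- 1#) φ) v (weight-P-0 φ v ¬h)

    -- Exponents in the ribbon graph and Tutte polynomials

    module _ {X y z b : Carrier} (b*X≈κ : b * X ≈ κ) (y≈b*κ : y ≈ b * κ) (z*κ≈1 : z * κ ≈ 1#) where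

      -- `X` stands for x - 1. The power of b from the prefactor splits into exponents r(A) and `d`:
      -- the first joins the b in y to give |A|, the second turns the powers of `X` into powers of
      -- `κ`. Altogether `κ` gets the exponent c(A) + n(A) = f(A) + `g`, and the power of z cancels
      -- the part `g`.
      R-term : ∀ A → κ ^ c G ⊤ * b ^ r G ⊤ *
                     (X ^ (r G ⊤ ∸ r G A) * y ^ n G A * z ^ ((c G A ℕ.+ n G A) ∸ f G A))
                   ≈ b ^ ∣ A ∣ * κ ^ f G A
      R-term A = begin
        κ ^ c G ⊤ * b ^ r G ⊤ * (X ^ d * y ^ n G A * z ^ g)
          ≈⟨ *-cong (*-congˡ (trans (^-congʳ b (≡.sym (ℕ.m+[n∸m]≡n (r-monotone G A))))
                 (^-homo-* b (r G A) d)))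
               (*-congʳ (*-congˡ (trans (^-congˡ (n G A) y≈b*κ) (^-distrib-* b κ (n G A))))) ⟩
        κ ^ c G ⊤ * (b ^ r G A * b ^ d) * (X ^ d * (b ^ n G A * κ ^ n G A) * z ^ g)
          ≈⟨ solve 7 (λ κᶜ bʳ bᵈ Xᵈ bⁿ κⁿ zᵍ →
               ((κᶜ ⊕ (bʳ ⊕ bᵈ)) ⊕ ((Xᵈ ⊕ (bⁿ ⊕ κⁿ)) ⊕ zᵍ)) ⊜
               ((bʳ ⊕ bⁿ) ⊕ (((κᶜ ⊕ (bᵈ ⊕ Xᵈ)) ⊕ κⁿ) ⊕ zᵍ))) refl
               (κ ^ c G ⊤) (b ^ r G A) (b ^ d) (X ^ d) (b ^ n G A) (κ ^ n G A) (z ^ g) ⟩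
        (b ^ r G A * b ^ n G A) * (κ ^ c G ⊤ * (b ^ d * X ^ d) * κ ^ n G A * z ^ g)
          ≈⟨ *-cong (trans (sym (^-homo-* b (r G A) (n G A))) (^-congʳ b (r+n G A)))
               (*-congʳ (*-congʳ (*-congˡ (trans (sym (^-distrib-* b X d)) (^-congˡ d b*X≈κ))))) ⟩
        b ^ ∣ A ∣ * (κ ^ c G ⊤ * κ ^ d * κ ^ n G A * z ^ g)
          ≈⟨ *-congˡ (*-congʳ (*-congʳ (trans (sym (^-homo-* κ (c G ⊤) d)) (^-congʳ κ (c⊤+[r⊤∸rA] G A))))) ⟩
        b ^ ∣ A ∣ * (κ ^ c G A * κ ^ n G A * z ^ g)
          ≈⟨ *-congˡ (*-congʳ (trans (sym (^-homo-* κ (c G A) (n G A)))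
               (trans (^-congʳ κ (≡.sym (ℕ.m+[n∸m]≡n (f≤c+n G A)))) (^-homo-* κ (f G A) g)))) ⟩
        b ^ ∣ A ∣ * (κ ^ f G A * κ ^ g * z ^ g)
          ≈⟨ *-congˡ (trans (*-assoc _ _ _) (*-congˡ (trans (*-comm _ _)
               (trans (sym (^-distrib-* z κ g)) (trans (^-congˡ g z*κ≈1) (1^ g)))))) ⟩
        b ^ ∣ A ∣ * (κ ^ f G A * 1#)
          ≈⟨ *-congˡ (*-identityʳ _) ⟩
        b ^ ∣ A ∣ * κ ^ f G A ∎
        where
        d = r G ⊤ ∸ r G A
        g = (c G A ℕ.+ n G A) ∸ f G A

    R≈∑-rPermissible : ∀ {x y z b} → b * (x - 1#) ≈ κ → y ≈ b * κ → z * κ ≈ 1# →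
      κ ^ c G ⊤ * b ^ r G ⊤ * R G x y z
        ≈ ∑ (𝓡 (medial G) k) (λ φ → (b + 1#) ^ tot (medial G) k φ * b ^ wh (medial G) k φ)
    R≈∑-rPermissible {b = b} b*X≈κ y≈b*κ z*κ≈1 = trans (∑-distribˡ _ (subsets m) _)
      (trans (∑-cong (subsets m) (R-term b*X≈κ y≈b*κ z*κ≈1)) (sym (∑-rPermissible b)))

    -- For a plane graph the power of z has exponent 0 and can be inserted freely. The terms are
    -- then those of `R-term` with y - 1 as its `y`.
    T≈∑-rPermissible : Plane G → ∀ {x y z b} → b * (x - 1#) ≈ κ → y - 1# ≈ b * κ → z * κ ≈ 1# →
      κ ^ c G ⊤ * b ^ r G ⊤ * T G x y
        ≈ ∑ (𝓡 (medial G) k) (λ φ → (b + 1#) ^ tot (medial G) k φ * b ^ wh (medial G) k φ)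
    T≈∑-rPermissible plane {z = z} {b} b*X≈κ y≈b*κ z*κ≈1 = trans (∑-distribˡ _ (subsets m) _)
      (trans (∑-cong (subsets m) λ A → trans
        (*-congˡ (trans (sym (*-identityʳ _)) (*-congˡ (^-congʳ z (≡.sym (plane-genus G plane A))))))
        (R-term b*X≈κ y≈b*κ z*κ≈1 A)) (sym (∑-rPermissible b)))

-- The four identities in a field of characteristic zero

mainTheorem2 :
    ∀ {a ℓ₁ ℓ₂} (K : HeytingField a ℓ₁ ℓ₂) →
    let open HeytingField K
        open Field K
    in
    (char0 : CharacteristicZero) (G : RibbonGraph) (k : ℕ) .{{_ : NonZero k}}
    (b : Carrier) (b#0 : b # 0#) →
    let Gₘ  = medial G
        κ   = ⟦ k ⟧
        κ#0 = char0 k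
    in
      (κ ^ c G ⊤ * R G (κ + 1#) κ (1# / κ [ κ#0 ])
        ≈ ∑ (𝓡 Gₘ k) (λ φ → ⟦ 2 ⟧ ^ tot Gₘ k φ))
      × (P G κ ≈ ∑ (𝓐 Gₘ k) (λ φ → (- 1#) ^ cr Gₘ k φ))
      × (κ ^ c G ⊤ * b ^ r G ⊤ * R G ((κ + b) / b [ b#0 ]) (b * κ) (1# / κ [ κ#0 ])
        ≈ ∑ (𝓡 Gₘ k) (λ φ → (b + 1#) ^ tot Gₘ k φ * b ^ wh Gₘ k φ))
      × (Plane G →
          κ ^ c G ⊤ * b ^ r G ⊤ * T G (κ / b [ b#0 ] + 1#) (κ * b + 1#)
            ≈ ∑ (𝓡 Gₘ k) (λ φ → (b + 1#) ^ tot Gₘ k φ * b ^ wh Gₘ k φ))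
mainTheorem2 K char0 G k b b#0 =
    -- The first identity is the case b = 1 of the third: the powers of 1 are inserted on the left
    -- and removed on the right, where 1 + 1 becomes `⟦ 2 ⟧`.
    trans (*-congʳ (trans (sym (*-identityʳ _)) (*-congˡ (sym (1^ (r G ⊤))))))
      (trans (R≈∑-rPermissible G k (trans (*-identityˡ _) (x+1-1≈x κ)) (sym (*-identityˡ κ)) κ⁻¹*κ≈1)
        (∑-cong (𝓡 Gₘ k) λ φ → trans (*-congˡ (1^ (wh Gₘ k φ)))
          (trans (*-identityʳ _) (^-congˡ (tot Gₘ k φ) (+-congˡ (sym (+-identityʳ 1#)))))))
  , P≈∑-admissible G k
  , R≈∑-rPermissible G k b*X≈κ refl κ⁻¹*κ≈1
  , λ plane → T≈∑-rPermissible G k plane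
      (trans (*-congˡ (x+1-1≈x (κ / b [ b#0 ]))) b*[κ/b]≈κ)
      (trans (x+1-1≈x (κ * b)) (*-comm κ b)) κ⁻¹*κ≈1
  where
  open HeytingField K using (_#_; #⇒invertible)
  open Field K hiding (_^_)
  open CommutativeRing commutativeRing
  open Sums commutativeRing hiding (κ)
  open import Algebra.Properties.Semiring.Exp semiring using (_^_; ^-congˡ)
  open import Algebra.Properties.AbelianGroup +-abelianGroup using () renaming (ε⁻¹≈ε to -0≈0)
  open import Relation.Binary.Reasoning.Setoid setoid

  Gₘ = medial G
  κ = ⟦ k ⟧

  x+1-1≈x : ∀ x → x + 1# - 1# ≈ x
  x+1-1≈x x = trans (+-assoc x 1# (- 1#)) (trans (+-congˡ (-‿inverseʳ 1#)) (+-identityʳ x))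

  -- The inverse at hand is one of y - 0, so this difference is first rewritten as y.
  /-inverse : ∀ {y} (y#0 : y # 0#) → y * proj₁ (#⇒invertible y#0) ≈ 1#
  /-inverse {y} y#0 = trans (*-congʳ (sym (trans (+-congˡ -0≈0) (+-identityʳ y))))
    (proj₂ (proj₂ (#⇒invertible y#0)))

  κ⁻¹*κ≈1 : 1# / κ [ char0 k ] * κ ≈ 1#
  κ⁻¹*κ≈1 = trans (*-congʳ (*-identityˡ _)) (trans (*-comm _ κ) (/-inverse (char0 k)))

  b*[x/b]≈x : ∀ x → b * (x / b [ b#0 ]) ≈ x
  b*[x/b]≈x x = trans (*-comm b _) (trans (*-assoc x _ b)
    (trans (*-congˡ (trans (*-comm _ b) (/-inverse b#0))) (*-identityʳ x)))

  b*[κ/b]≈κ : b * (κ / b [ b#0 ]) ≈ κ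
  b*[κ/b]≈κ = b*[x/b]≈x κ

  b*X≈κ : b * ((κ + b) / b [ b#0 ] - 1#) ≈ κ
  b*X≈κ = begin
    b * ((κ + b) / b [ b#0 ] - 1#)
      ≈⟨ distribˡ b _ _ ⟩
    b * ((κ + b) / b [ b#0 ]) + b * - 1#
      ≈⟨ +-cong (b*[x/b]≈x (κ + b)) (trans (sym (-‿distribʳ-* b 1#)) (-‿cong (*-identityʳ b))) ⟩
    κ + b - b
      ≈⟨ trans (+-assoc κ b (- b)) (trans (+-congˡ (-‿inverseʳ b)) (+-identityʳ κ)) ⟩
    κ ∎
    where open import Algebra.Properties.Ring ring using (-‿distribʳ-*)
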